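{- The problem Min-Quasi-Kernel is solvable in polynomial time on orientations of trees: there is a polynomial-time algorithm that, given a digraph $T$ that is an orientation of a finite tree, computes a quasi-kernel of $T$ of minimum size.
   Context: An orientation of an undirected graph is a digraph obtained by giving each edge exactly one of its two possible directions. A subset of vertices of a digraph is independent if all pairs of distinct vertices in it are non-adjacent. The directed distance $d(v,w)$ is the minimum length of a directed path from $v$ to $w$. A quasi-kernel of a digraph $D=(V,A)$ is an independent subset $Q \subseteq V$ such that for every $v \in V \setminus Q$ there exists $w \in Q$ with $d(v,w) \leq 2$. Min-Quasi-Kernel is the problem of finding, in a given digraph, a quasi-kernel of minimum size. -}

module Defs where

open import Data.Bool using (Bool; true; false; T)
open import Data.Fin using (Fin; zero; suc; inject₁; fromℕ)
open import Data.Fin.Subset using (Subset; _∈_; _∉_; ∣_∣)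
open import Data.Nat using (ℕ; zero; suc; _+_; _*_; _^_; _≤_; NonZero)
open import Data.Product using (Σ; ∃; ∃-syntax; _×_; _,_)
open import Data.Sum using (_⊎_)
open import Data.Vec using (Vec; []; _∷_; lookup; tabulate)
open import Function.Definitions using (Injective)
open import Level using (0ℓ)
open import Relation.Binary.Core using (Rel)
open import Relation.Binary.Definitions using (Symmetric; Irreflexive)
open import Relation.Binary.PropositionalEquality using (_≡_; _≢_; refl)
open import Relation.Nullary using (¬_)

------------------------------------------------------------------------
-- Graphs and digraphs on the vertex set Fin n

-- Directed path with k arcs, hence k + 1 pairwise distinct vertices.  For a
-- symmetric relation this is a path of an undirected graph.
record Path {n : ℕ} (_⟶_ : Rel (Fin n) 0ℓ) (v w : Fin n) (k : ℕ) : Set where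
  field
    vertex   : Fin (suc k) → Fin n
    distinct : Injective _≡_ _≡_ vertex
    starts   : vertex zero ≡ v
    ends     : vertex (fromℕ k) ≡ w
    step     : ∀ (i : Fin k) → vertex (inject₁ i) ⟶ vertex (suc i)

record Graph (n : ℕ) : Set₁ where
  field
    Edge   : Rel (Fin n) 0ℓ
    sym    : Symmetric Edge
    irrefl : Irreflexive _≡_ Edge

open Graph public using (Edge)

Connected : {n : ℕ} → Graph n → Set
Connected G = ∀ v w → ∃[ k ] Path (Edge G) v w k

-- A cycle is a path on at least three vertices closed up by an edge.
Cycle : {n : ℕ} → Graph n → Set
Cycle G = ∃[ v ] ∃[ w ] ∃[ k ] (Path (Edge G) v w (2 + k) × Edge G w v)

record IsTree {n : ℕ} (G : Graph n) : Set where
  field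
    nonempty  : NonZero n
    connected : Connected G
    acyclic   : ¬ Cycle G

-- Adjacency matrix; Boolean-valued since digraphs are inputs of algorithms.
Digraph : ℕ → Set
Digraph n = Fin n → Fin n → Bool

Arc : {n : ℕ} → Digraph n → Rel (Fin n) 0ℓ
Arc D v w = T (D v w)

record IsOrientationOf {n : ℕ} (D : Digraph n) (G : Graph n) : Set where
  field
    arc⇒edge : ∀ {v w} → Arc D v w → Edge G v w
    edge⇒arc : ∀ {v w} → Edge G v w →
               (Arc D v w × ¬ Arc D w v) ⊎ (¬ Arc D v w × Arc D w v)

IsOrientedTree : {n : ℕ} → Digraph n → Set₁
IsOrientedTree {n} D = Σ (Graph n) λ G → IsTree G × IsOrientationOf D G

------------------------------------------------------------------------
-- Quasi-kernels

Independent : {n : ℕ} → Digraph n → Subset n → Set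
Independent D Q =
  ∀ {v w} → v ∈ Q → w ∈ Q → v ≢ w → ¬ (Arc D v w ⊎ Arc D w v)

-- d(v,w) = k.  The distance is undefined (infinite) when there is no path.
IsDistance : {n : ℕ} → Digraph n → Fin n → Fin n → ℕ → Set
IsDistance D v w k =
  Path (Arc D) v w k × (∀ j → Path (Arc D) v w j → k ≤ j)

record IsQuasiKernel {n : ℕ} (D : Digraph n) (Q : Subset n) : Set where
  field
    independent : Independent D Q
    absorbing   : ∀ v → v ∉ Q →
                  ∃[ w ] (w ∈ Q × ∃[ k ] (IsDistance D v w k × k ≤ 2))

IsMinQuasiKernel : {n : ℕ} → Digraph n → Subset n → Set
IsMinQuasiKernel D Q =
  IsQuasiKernel D Q × (∀ Q′ → IsQuasiKernel D Q′ → ∣ Q ∣ ≤ ∣ Q′ ∣)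

------------------------------------------------------------------------
-- Model of computation: first-order recursive programs (pure Lisp) over
-- binary trees, as in N. D. Jones, "Computability and Complexity from a
-- Programming Perspective".

data Value : Set where
  nil  : Value
  cons : Value → Value → Value

size : Value → ℕ
size nil        = 1
size (cons a b) = 1 + size a + size b

-- Expressions with k variables in scope (de Bruijn indices), over m
-- functions with the given arities.
data Expr {m : ℕ} (arity : Fin m → ℕ) (k : ℕ) : Set where
  var     : Fin k → Expr arity k
  nil     : Expr arity k
  cons    : Expr arity k → Expr arity k → Expr arity k
  -- In the third argument, variable 0 is the left and variable 1 the right
  -- component of the pair.
  case    : Expr arity k → Expr arity k → Expr arity (2 + k) → Expr arity k
  letin   : Expr arity k → Expr arity (1 + k) → Expr arity k
  call    : (f : Fin m) → Vec (Expr arity k) (arity f) → Expr arity k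

-- The function definitions may be mutually recursive without restriction.
record Program : Set where
  field
    #functions : ℕ
    arity      : Fin #functions → ℕ
    body       : ∀ f → Expr arity (arity f)
    main       : Expr arity 1

-- Call-by-value evaluation.  `ρ ⊢ e ⇓ a ⟨ t ⟩` says that e terminates with
-- value a in environment ρ after t unit steps, one for each rule of the
-- derivation that evaluates an expression.  For a fixed program each such step
-- takes constant time on a pointer machine, where cons allocates one cell
-- sharing its components and the only test is nil versus cons.  Up to a
-- polynomial, t is therefore Turing machine time, as long as the value finally
-- written out (where sharing could hide an exponential size) is of polynomial
-- size.
module Evaluation {m : ℕ} {arity : Fin m → ℕ}
                  (body : ∀ f → Expr arity (arity f)) where

  infix 4 _⊢_⇓_⟨_⟩ _⊢_⇓*_⟨_⟩

  mutual
    data _⊢_⇓_⟨_⟩ {k : ℕ} (ρ : Vec Value k) :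
                  Expr arity k → Value → ℕ → Set where
      var   : ∀ {x} → ρ ⊢ var x ⇓ lookup ρ x ⟨ 1 ⟩
      nil   : ρ ⊢ nil ⇓ nil ⟨ 1 ⟩
      cons  : ∀ {e₁ e₂ a₁ a₂ t₁ t₂} →
              ρ ⊢ e₁ ⇓ a₁ ⟨ t₁ ⟩ → ρ ⊢ e₂ ⇓ a₂ ⟨ t₂ ⟩ →
              ρ ⊢ cons e₁ e₂ ⇓ cons a₁ a₂ ⟨ 1 + t₁ + t₂ ⟩
      case-nil  : ∀ {e e₁ e₂ a t t₁} →
              ρ ⊢ e ⇓ nil ⟨ t ⟩ → ρ ⊢ e₁ ⇓ a ⟨ t₁ ⟩ →
              ρ ⊢ case e e₁ e₂ ⇓ a ⟨ 1 + t + t₁ ⟩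
      case-cons : ∀ {e e₁ e₂ b c a t t₂} →
              ρ ⊢ e ⇓ cons b c ⟨ t ⟩ → b ∷ c ∷ ρ ⊢ e₂ ⇓ a ⟨ t₂ ⟩ →
              ρ ⊢ case e e₁ e₂ ⇓ a ⟨ 1 + t + t₂ ⟩
      letin : ∀ {e₁ e₂ a₁ a t₁ t₂} →
              ρ ⊢ e₁ ⇓ a₁ ⟨ t₁ ⟩ → a₁ ∷ ρ ⊢ e₂ ⇓ a ⟨ t₂ ⟩ →
              ρ ⊢ letin e₁ e₂ ⇓ a ⟨ 1 + t₁ + t₂ ⟩
      call  : ∀ {f es as a t₁ t₂} →
              ρ ⊢ es ⇓* as ⟨ t₁ ⟩ → as ⊢ body f ⇓ a ⟨ t₂ ⟩ →
              ρ ⊢ call f es ⇓ a ⟨ 1 + t₁ + t₂ ⟩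

    data _⊢_⇓*_⟨_⟩ {k : ℕ} (ρ : Vec Value k) :
                   ∀ {l} → Vec (Expr arity k) l → Vec Value l → ℕ → Set where
      []  : ρ ⊢ [] ⇓* [] ⟨ 0 ⟩
      _∷_ : ∀ {l e a t₁ t₂} {es : Vec (Expr arity k) l} {as : Vec Value l} →
            ρ ⊢ e ⇓ a ⟨ t₁ ⟩ → ρ ⊢ es ⇓* as ⟨ t₂ ⟩ →
            ρ ⊢ e ∷ es ⇓* a ∷ as ⟨ t₁ + t₂ ⟩

  deterministic : ∀ {k} {ρ : Vec Value k} {e a a′ t t′} →
    ρ ⊢ e ⇓ a ⟨ t ⟩ → ρ ⊢ e ⇓ a′ ⟨ t′ ⟩ → (a , t) ≡ (a′ , t′)
  deterministic* : ∀ {k l} {ρ : Vec Value k} {es : Vec (Expr arity k) l}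
    {as as′ t t′} →
    ρ ⊢ es ⇓* as ⟨ t ⟩ → ρ ⊢ es ⇓* as′ ⟨ t′ ⟩ → (as , t) ≡ (as′ , t′)

  deterministic var var = refl
  deterministic nil nil = refl
  deterministic (cons p q) (cons p′ q′)
    with refl ← deterministic p p′ | refl ← deterministic q q′ = refl
  deterministic (case-nil p q) (case-nil p′ q′)
    with refl ← deterministic p p′ | refl ← deterministic q q′ = refl
  deterministic (case-nil p q) (case-cons p′ q′)
    with () ← deterministic p p′
  deterministic (case-cons p q) (case-nil p′ q′)
    with () ← deterministic p p′
  deterministic (case-cons p q) (case-cons p′ q′)
    with refl ← deterministic p p′
    with refl ← deterministic q q′ = refl
  deterministic (letin p q) (letin p′ q′)
    with refl ← deterministic p p′
    with refl ← deterministic q q′ = refl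
  deterministic (call p q) (call p′ q′)
    with refl ← deterministic* p p′
    with refl ← deterministic q q′ = refl

  deterministic* [] [] = refl
  deterministic* (p ∷ ps) (p′ ∷ ps′)
    with refl ← deterministic p p′ | refl ← deterministic* ps ps′ = refl

Runs : Program → Value → Value → ℕ → Set
Runs P input output t = (input ∷ []) ⊢ main ⇓ output ⟨ t ⟩
  where open Program P
        open Evaluation body

------------------------------------------------------------------------
-- Polynomial-time solvability of search problems

record SearchProblem : Set₁ where
  field
    Instance     : Set
    Answer       : Instance → Set
    Solves       : (i : Instance) → Answer i → Set
    encode       : Instance → Value
    encodeAnswer : (i : Instance) → Answer i → Value

-- Nothing is required of the program on instances outside the class C.
PolynomialTimeSolvableOn : (Π : SearchProblem) →
                           (SearchProblem.Instance Π → Set₁) → Set₁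
PolynomialTimeSolvableOn Π C =
  Σ Program λ P → ∃[ c ] ∃[ d ] (∀ i → C i →
    ∃[ a ] (Solves i a ×
      ∃[ t ] (Runs P (encode i) (encodeAnswer i a) t ×
              t ≤ c * size (encode i) ^ d + c)))
  where open SearchProblem Π

encodeBool : Bool → Value
encodeBool false = nil
encodeBool true  = cons nil nil

encodeVec : {A : Set} → (A → Value) → {n : ℕ} → Vec A n → Value
encodeVec enc []       = nil
encodeVec enc (x ∷ xs) = cons (enc x) (encodeVec enc xs)

-- The list of rows of the adjacency matrix.
encodeDigraph : {n : ℕ} → Digraph n → Value
encodeDigraph D =
  encodeVec (encodeVec encodeBool) (tabulate λ v → tabulate λ w → D v w)

-- Answers are characteristic bit vectors, so their encodings have size linear
-- in the number of vertices.
MinQuasiKernel : SearchProblem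
MinQuasiKernel = record
  { Instance     = Σ ℕ Digraph
  ; Answer       = λ (n , D) → Subset n
  ; Solves       = λ (n , D) Q → IsMinQuasiKernel D Q
  ; encode       = λ (n , D) → encodeDigraph D
  ; encodeAnswer = λ (n , D) Q → encodeVec encodeBool Q
  }

OrientationsOfTrees : SearchProblem.Instance MinQuasiKernel → Set₁
OrientationsOfTrees (n , D) = IsOrientedTree D

{-# OPTIONS --safe #-}
module Submission where

open import Data.Bool using (Bool; true; false; T; if_then_else_; _∨_)
open import Data.Bool.Properties using (T?; ∨-identityʳ)
open import Data.Empty using (⊥-elim)
open import Data.Fin using (Fin; zero; suc; toℕ; inject₁; fromℕ)
open import Data.Fin.Patterns
open import Data.Fin.Properties using (all?; any?; injective⇒≤)
  renaming (_≟_ to _≟ᶠ_; suc-injective to suc-injectiveᶠ)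
open import Data.Fin.Subset using (Subset; _∪_; ∣_∣; ⊥; ⁅_⁆; _∈_; _∉_)
open import Data.Fin.Subset.Properties using
  (x∈⁅x⁆; x∈⁅y⁆⇒x≡y; ∉⊥; _∈?_; ∣⊥∣≡0; ∣⁅x⁆∣≡1; x∈p∪q⁺; x∈p∪q⁻;
   ∪-assoc; ∪-comm; ∪-identityˡ; ∪-identityʳ)
open import Data.List as List using (List; []; _∷_; filter; filterᵇ; foldr; map)
open import Data.List.Membership.Propositional using (find) renaming (_∈_ to _∈ˡ_)
open import Data.List.Membership.Propositional.Properties using
  (∈-++⁺ˡ; ∈-++⁺ʳ; ∈-++⁻; ∈-allFin; ∈-filter⁺; ∈-filter⁻; ∈-map⁻;
   ∈-tabulate⁺; ∈-tabulate⁻; ∈-∃++)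
import Data.List.Properties as List
open import Data.List.Relation.Unary.All as All using (All; []; _∷_)
open import Data.List.Relation.Unary.All.Properties as All using (++⁺)
open import Data.List.Relation.Unary.AllPairs using ([]; _∷_)
open import Data.List.Relation.Unary.Any as Any using (Any; here; there)
open import Data.List.Relation.Unary.Unique.Propositional using (Unique)
import Data.List.Relation.Unary.Unique.Propositional.Properties as Unique
open import Data.Maybe using (Maybe; just; nothing)
open import Data.Nat using (ℕ; zero; suc; _+_; _*_; _^_; _≤_; z≤n; s≤s; _≤?_)
open import Data.Nat.ListAction using (sum)
open import Data.Nat.Properties
open import Data.Nat.Solver using (module +-*-Solver)
open import Data.Product using (Σ; ∃-syntax; _×_; _,_; proj₁; proj₂; uncurry)
open import Data.Sum using (inj₁; inj₂)
open import Data.Unit using (tt)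
open import Data.Vec as Vec using (Vec; []; _∷_; _++_; lookup; tabulate)
open import Data.Vec.Properties using
  (lookup-replicate; lookup∘tabulate; lookup⇒[]=; []=⇒lookup; tabulate-∘)
open import Function using (_∘_)
open import Function.Definitions using (Injective)
open import Relation.Binary.PropositionalEquality
open import Relation.Nullary using (¬_; yes; no; ¬?; recompute)
open import Relation.Nullary.Decidable using (_×-dec_; toWitness)
open import Relation.Nullary.Negation using (contradiction)

open import Defs

-- Give every vertex v a label: v is in the quasi-kernel, or has a chosen
-- out-neighbour in it, or has a chosen out-neighbour with a label of the second
-- kind.  Quasi-kernels are then the solutions of a binary constraint problem
-- whose constraints are trivial between non-adjacent vertices.  On a forest it is
-- solved by repeatedly finding a vertex v with at most one remaining neighbour u
-- and adding to each label of u the cheapest compatible label of v.  That some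
-- solution exists at all is the theorem of Chvátal and Lovász.

-- The program and its running time

-- That some out-neighbour of `v` is of a certain kind is a condition on a whole neighbourhood.
-- Putting the witness into the label leaves only conditions on pairs joined by an arc, at the price
-- of `1 + 2d` labels for a vertex of out-degree `d`; this price is polynomial, so tables stay
-- small. The language has neither numbers nor an equality test. Vertices are therefore unit bit
-- vectors, and a single test, whether two bit vectors meet, decides adjacency of vertices as well
-- as compatibility of labels. As long as every remaining vertex has two remaining neighbours, the
-- program only rotates its list. On general inputs it need not halt, so its runs are described by a
-- relation rather than by a function, and termination is proved together with optimality by
-- induction on the number of remaining vertices.

arity : Fin 16 → ℕ
arity = lookup (2 ∷ 2 ∷ 2 ∷ 2 ∷ 2 ∷ 2 ∷ 2 ∷ 2 ∷ 2 ∷ 2 ∷ 1 ∷ 1 ∷ 1 ∷ 3 ∷ 4 ∷ 4 ∷ [])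

pattern appendᶠ   = zero
pattern meetsᶠ    = suc appendᶠ
pattern clashᶠ    = suc meetsᶠ
pattern unionᶠ    = suc clashᶠ
pattern leqᶠ      = suc unionᶠ
pattern bestᶠ     = suc leqᶠ
pattern mergeᶠ    = suc bestᶠ
pattern nbrsᶠ     = suc mergeᶠ
pattern absorbᶠ   = suc nbrsᶠ
pattern loopᶠ     = suc absorbᶠ
pattern zerosᶠ    = suc loopᶠ
pattern shiftᶠ    = suc zerosᶠ
pattern unitsᶠ    = suc shiftᶠ
pattern tripleᶠ   = suc unitsᶠ
pattern pointersᶠ = suc tripleᶠ
pattern recordsᶠ  = suc pointersᶠ

pattern # x = var x
pattern one-bit = cons nil nil
pattern call₁ f a = call f (a ∷ [])
pattern call₂ f a b = call f (a ∷ b ∷ [])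
pattern call₃ f a b c = call f (a ∷ b ∷ c ∷ [])
pattern call₄ f a b c d = call f (a ∷ b ∷ c ∷ d ∷ [])

-- Except in the tail-recursive `loopᶠ`, a function that calls others besides itself binds its
-- recursive call by `letin` before branching. The call is then made once, and its cost comes first,
-- as in `loopCost`.
body : ∀ f → Expr arity (arity f)
body appendᶠ =
  case (# 0F) (# 1F) (cons (# 0F) (call₂ appendᶠ (# 1F) (# 3F)))
body meetsᶠ =
  case (# 0F) nil (case (# 3F) nil
    (case (# 2F) (call₂ meetsᶠ (# 3F) (# 1F))
      (case (# 2F) (call₂ meetsᶠ (# 5F) (# 3F)) one-bit)))
body clashᶠ =
  case (# 0F) nil (case (# 0F) nil (case (# 5F) nil (case (# 0F) nil
    (case (call₂ meetsᶠ (# 5F) (# 0F)) (call₂ meetsᶠ (# 1F) (# 4F)) one-bit))))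
body unionᶠ =
  case (# 0F) nil (case (# 3F) nil
    (cons (case (# 2F) (# 0F) one-bit) (call₂ unionᶠ (# 3F) (# 1F))))
body leqᶠ =
  case (# 0F) one-bit (case (# 0F) (call₂ leqᶠ (# 1F) (# 3F))
    (case (# 5F) nil (case (# 0F) (call₂ leqᶠ (# 6F) (# 1F))
      (call₂ leqᶠ (# 7F) (# 3F)))))
body bestᶠ =
  case (# 1F) nil (letin (call₂ bestᶠ (# 2F) (# 1F))
    (case (call₂ clashᶠ (# 3F) (# 1F))
      (case (# 1F) nil (case (# 2F) (cons (# 1F) nil)
        (case (call₂ leqᶠ (# 3F) (# 0F)) (# 4F) (cons (# 5F) nil))))
      (# 2F)))
body mergeᶠ =
  case (# 0F) nil (letin (call₂ mergeᶠ (# 1F) (# 3F))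
    (case (call₂ bestᶠ (# 1F) (# 4F)) (# 0F)
      (case (# 3F) nil
        (cons (cons (# 0F) (call₂ unionᶠ (# 1F) (# 2F))) (# 4F)))))
body nbrsᶠ =
  case (# 1F) nil (letin (call₂ nbrsᶠ (# 2F) (# 1F))
    (case (call₂ clashᶠ (# 3F) (# 1F)) (# 0F) (cons (# 3F) (# 2F))))
body absorbᶠ =
  case (# 1F) nil (letin (call₂ absorbᶠ (# 2F) (# 1F))
    (case (call₂ clashᶠ (# 3F) (# 1F)) (cons (# 1F) (# 0F))
      (case (# 3F) nil (case (# 7F) nil
        (cons (cons (# 2F) (call₂ mergeᶠ (# 3F) (# 1F))) (# 8F))))))
body loopᶠ =
  case (# 1F) (# 0F) (case (call₂ nbrsᶠ (# 0F) (# 1F))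
    (case (# 0F) nil
      -- The default `nil` answers for an empty table, which never occurs in a feasible list of
      -- records.
      (case (call₂ bestᶠ (cons (cons nil nil) nil) (# 1F)) nil
        (call₂ loopᶠ (call₂ unionᶠ (# 6F) (# 0F)) (# 5F))))
    (case (# 1F)
      (call₂ loopᶠ (# 4F) (call₂ absorbᶠ (# 2F) (# 3F)))
      (call₂ loopᶠ (# 6F) (call₂ appendᶠ (# 5F) (cons (# 4F) nil)))))
body zerosᶠ = case (# 0F) nil (cons nil (call₁ zerosᶠ (# 1F)))
body shiftᶠ = case (# 0F) nil (cons (cons nil (# 0F)) (call₁ shiftᶠ (# 1F)))
body unitsᶠ =
  case (# 0F) nil (letin (call₁ unitsᶠ (# 1F))
    (cons (cons one-bit (call₁ zerosᶠ (# 2F))) (call₁ shiftᶠ (# 0F))))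
body tripleᶠ = call₂ appendᶠ (# 0F) (call₂ appendᶠ (# 1F) (# 2F))
body pointersᶠ =
  case (# 2F) nil (case (# 5F) nil
    (letin (call₄ pointersᶠ (# 4F) (# 5F) (# 3F) (# 1F))
      (case (# 3F) (# 0F)
        (cons (cons (cons (call₃ tripleᶠ (# 8F) (# 7F) (# 8F))
                          (call₃ tripleᶠ (# 8F) (# 3F) (# 3F))) (# 8F))
          (cons (cons (cons (call₃ tripleᶠ (# 8F) (# 8F) (# 7F))
                            (call₃ tripleᶠ (# 3F) (# 8F) (# 3F))) (# 8F))
            (# 2F))))))
body recordsᶠ =
  case (# 1F) nil (case (# 4F) nil
    (letin (call₄ recordsᶠ (# 4F) (# 3F) (# 1F) (# 7F))
      (cons (cons (cons (# 1F) (# 3F))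
              (cons (cons (cons (call₃ tripleᶠ (# 1F) (# 5F) (# 5F))
                                (call₃ tripleᶠ (# 3F) (# 5F) (# 5F))) (# 1F))
                (call₄ pointersᶠ (# 1F) (# 5F) (# 3F) (# 8F))))
        (# 0F))))

minQuasiKernel : Program
minQuasiKernel = record
  { #functions = 16
  ; arity      = arity
  ; body       = body
  ; main       = letin (call₁ zerosᶠ (# 0F)) (letin (call₁ unitsᶠ (# 1F))
      (call₂ loopᶠ (# 1F) (call₄ recordsᶠ (# 1F) (# 2F) (# 0F) (# 0F))))
  }

open Evaluation body

-- Evaluation within a time budget

mutual
  exprSize : ∀ {k} → Expr arity k → ℕ
  exprSize (var x)         = 1
  exprSize nil             = 1
  exprSize (cons e₁ e₂)    = 1 + (exprSize e₁ + exprSize e₂)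
  exprSize (case e e₁ e₂)  = 1 + (exprSize e + (exprSize e₁ + exprSize e₂))
  exprSize (letin e₁ e₂)   = 1 + (exprSize e₁ + exprSize e₂)
  exprSize (call f es)     = 1 + exprsSize es

  exprsSize : ∀ {k l} → Vec (Expr arity k) l → ℕ
  exprsSize []       = 0
  exprsSize (e ∷ es) = exprSize e + exprsSize es

opaque
  -- Opaque, so that costs keep the symbol instead of unfolding the numeral. All that matters about
  -- the value is that no body is larger.
  overhead : ℕ
  overhead = 100

  exprSize-body : ∀ f → exprSize (body f) ≤ overhead
  exprSize-body = toWitness {a? = all? λ f → exprSize (body f) ≤? 100} tt

-- Expressions contain no loops, so apart from the calls an evaluation takes at
-- most exprSize e steps.  The budget b for the calls is threaded through the
-- evaluation; b′ is what remains of it.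
infix 4 _⊢_⇓_[_↝_] _⊢_⇓*_[_↝_]

record _⊢_⇓_[_↝_] {k} (ρ : Vec Value k) (e : Expr arity k) (a : Value)
                  (b b′ : ℕ) : Set where
  constructor within
  field
    {time}     : ℕ
    derivation : ρ ⊢ e ⇓ a ⟨ time ⟩
    bound      : time + b′ ≤ exprSize e + b

record _⊢_⇓*_[_↝_] {k l} (ρ : Vec Value k) (es : Vec (Expr arity k) l)
                   (as : Vec Value l) (b b′ : ℕ) : Set where
  constructor within
  field
    {time}     : ℕ
    derivation : ρ ⊢ es ⇓* as ⟨ time ⟩
    bound      : time + b′ ≤ exprsSize es + b

record Computes (f : Fin 16) (as : Vec Value (arity f)) (a : Value) (T : ℕ) :
                Set where
  constructor within
  field
    {time}     : ℕ
    derivation : as ⊢ body f ⇓ a ⟨ time ⟩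
    bound      : time ≤ T

sequential : ∀ t₁ t₂ s₁ s₂ {b b₁ b₂} → t₁ + b₁ ≤ s₁ + b → t₂ + b₂ ≤ s₂ + b₁ →
             (t₁ + t₂) + b₂ ≤ (s₁ + s₂) + b
sequential t₁ t₂ s₁ s₂ {b} {b₁} {b₂} p q = begin
  t₁ + t₂ + b₂    ≡⟨ +-assoc t₁ t₂ b₂ ⟩
  t₁ + (t₂ + b₂)  ≤⟨ +-monoʳ-≤ t₁ q ⟩
  t₁ + (s₂ + b₁)  ≡⟨ lemma t₁ s₂ b₁ ⟩
  s₂ + (t₁ + b₁)  ≤⟨ +-monoʳ-≤ s₂ p ⟩
  s₂ + (s₁ + b)   ≡⟨ lemma′ s₂ s₁ b ⟩
  s₁ + s₂ + b     ∎
  where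
  open ≤-Reasoning
  open +-*-Solver
  lemma : ∀ x y z → x + (y + z) ≡ y + (x + z)
  lemma = solve 3 (λ x y z → x :+ (y :+ z) := y :+ (x :+ z)) refl
  lemma′ : ∀ x y z → x + (y + z) ≡ y + x + z
  lemma′ = solve 3 (λ x y z → x :+ (y :+ z) := y :+ x :+ z) refl

module _ {k : ℕ} {ρ : Vec Value k} where

  varᵉ : ∀ {x b} → ρ ⊢ var x ⇓ lookup ρ x [ b ↝ b ]
  varᵉ = within var ≤-refl

  nilᵉ : ∀ {b} → ρ ⊢ nil ⇓ nil [ b ↝ b ]
  nilᵉ = within nil ≤-refl

  consᵉ : ∀ {e₁ e₂ a₁ a₂ b b₁ b₂} →
          ρ ⊢ e₁ ⇓ a₁ [ b ↝ b₁ ] → ρ ⊢ e₂ ⇓ a₂ [ b₁ ↝ b₂ ] →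
          ρ ⊢ cons e₁ e₂ ⇓ cons a₁ a₂ [ b ↝ b₂ ]
  consᵉ {e₁} {e₂} (within {t₁} p t₁≤) (within {t₂} q t₂≤) =
    within (cons p q) (s≤s (sequential t₁ t₂ (exprSize e₁) (exprSize e₂) t₁≤ t₂≤))

  letinᵉ : ∀ {e₁ e₂ a₁ a b b₁ b₂} →
           ρ ⊢ e₁ ⇓ a₁ [ b ↝ b₁ ] → a₁ ∷ ρ ⊢ e₂ ⇓ a [ b₁ ↝ b₂ ] →
           ρ ⊢ letin e₁ e₂ ⇓ a [ b ↝ b₂ ]
  letinᵉ {e₁} {e₂} (within {t₁} p t₁≤) (within {t₂} q t₂≤) =
    within (letin p q) (s≤s (sequential t₁ t₂ (exprSize e₁) (exprSize e₂) t₁≤ t₂≤))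

  case-nilᵉ : ∀ {e e₁ e₂ a b b₁ b₂} →
              ρ ⊢ e ⇓ nil [ b ↝ b₁ ] → ρ ⊢ e₁ ⇓ a [ b₁ ↝ b₂ ] →
              ρ ⊢ case e e₁ e₂ ⇓ a [ b ↝ b₂ ]
  case-nilᵉ {e} {e₁} {e₂} (within {t₁} p t₁≤) (within {t₂} q t₂≤) =
    within (case-nil p q) (s≤s
      (sequential t₁ t₂ (exprSize e) (exprSize e₁ + exprSize e₂) t₁≤
        (≤-trans t₂≤ (+-monoˡ-≤ _ (m≤m+n (exprSize e₁) (exprSize e₂))))))

  case-consᵉ : ∀ {e e₁ e₂ x y a b b₁ b₂} →
               ρ ⊢ e ⇓ cons x y [ b ↝ b₁ ] →
               x ∷ y ∷ ρ ⊢ e₂ ⇓ a [ b₁ ↝ b₂ ] →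
               ρ ⊢ case e e₁ e₂ ⇓ a [ b ↝ b₂ ]
  case-consᵉ {e} {e₁} {e₂} (within {t₁} p t₁≤) (within {t₂} q t₂≤) =
    within (case-cons p q) (s≤s
      (sequential t₁ t₂ (exprSize e) (exprSize e₁ + exprSize e₂) t₁≤
        (≤-trans t₂≤ (+-monoˡ-≤ _ (m≤n+m (exprSize e₂) (exprSize e₁))))))

  -- Both branches have to leave the same budget, so the cheaper one is padded by `spareᵉ`. In
  -- return, proofs about programs need not split on `c`.
  ifᵉ : ∀ {e e₁ e₂ c b b₁ b₂} {A : Set} (f : A → Value) {x y : A} →
        ρ ⊢ e ⇓ encodeBool c [ b ↝ b₁ ] →
        nil ∷ nil ∷ ρ ⊢ e₂ ⇓ f x [ b₁ ↝ b₂ ] →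
        ρ ⊢ e₁ ⇓ f y [ b₁ ↝ b₂ ] →
        ρ ⊢ case e e₁ e₂ ⇓ f (if c then x else y) [ b ↝ b₂ ]
  ifᵉ {c = true}  f p q r = case-consᵉ p q
  ifᵉ {c = false} f p q r = case-nilᵉ p r

  []ᵉ : ∀ {b} → ρ ⊢ [] ⇓* [] [ b ↝ b ]
  []ᵉ = within [] ≤-refl

  infixr 5 _∷ᵉ_
  _∷ᵉ_ : ∀ {l e a} {es : Vec _ l} {as b b₁ b₂} →
         ρ ⊢ e ⇓ a [ b ↝ b₁ ] → ρ ⊢ es ⇓* as [ b₁ ↝ b₂ ] →
         ρ ⊢ e ∷ es ⇓* a ∷ as [ b ↝ b₂ ]
  _∷ᵉ_ {e = e} {es = es} (within {t₁} p t₁≤) (within {t₂} q t₂≤) =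
    within (p ∷ q) (sequential t₁ t₂ (exprSize e) (exprsSize es) t₁≤ t₂≤)

  vars₃ : ∀ {x y z b} → ρ ⊢ # x ∷ # y ∷ # z ∷ [] ⇓*
          lookup ρ x ∷ lookup ρ y ∷ lookup ρ z ∷ [] [ b ↝ b ]
  vars₃ = varᵉ ∷ᵉ varᵉ ∷ᵉ varᵉ ∷ᵉ []ᵉ

  callᵉ : ∀ {f es as a T b b′} →
          ρ ⊢ es ⇓* as [ b ↝ T + b′ ] → Computes f as a T →
          ρ ⊢ call f es ⇓ a [ b ↝ b′ ]
  callᵉ {es = es} {T = T} {b′ = b′} (within {t₁} p t₁≤) (within {t₂} q t₂≤) =
    within (call p q) (s≤s (≤-trans
      (≤-reflexive (+-assoc t₁ t₂ b′))
      (≤-trans (+-monoʳ-≤ t₁ (+-monoˡ-≤ b′ t₂≤)) t₁≤)))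

  spareᵉ : ∀ {e a b b₁ b₂} → b₂ ≤ b₁ → ρ ⊢ e ⇓ a [ b ↝ b₁ ] →
           ρ ⊢ e ⇓ a [ b ↝ b₂ ]
  spareᵉ b₂≤b₁ (within {t} p t≤) = within p (≤-trans (+-monoʳ-≤ t b₂≤b₁) t≤)

-- Since the final budget is `0`, unification reads `b` off the derivation as
-- `T₁ + (T₂ + (... + 0))`, the costs of the calls in the order of evaluation. Hence the nesting and
-- the trailing zeros in the costs below.
finishᵉ : ∀ {f as a b} → as ⊢ body f ⇓ a [ b ↝ 0 ] →
          Computes f as a (overhead + b)
finishᵉ {f} (within {t} p t≤) = within p
  (≤-trans (≤-reflexive (sym (+-identityʳ t)))
           (≤-trans t≤ (+-monoˡ-≤ _ (exprSize-body f))))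

Computes-≤ : ∀ {f as a T T′} → T ≤ T′ → Computes f as a T → Computes f as a T′
Computes-≤ T≤T′ (within p t≤) = within p (≤-trans t≤ T≤T′)

Computes-≡ : ∀ {f as a a′ T} → a ≡ a′ → Computes f as a T → Computes f as a′ T
Computes-≡ refl p = p

-- Bounds a recursion of depth `k` whose levels spend `c` each on calls of other functions.
loopCost : ℕ → ℕ → ℕ
loopCost c zero    = overhead + 0
loopCost c (suc k) = overhead + (loopCost c k + c)

-- Operations on bit vectors

bits : ∀ {m} → Subset m → Value
bits = encodeVec encodeBool

encodeList : {A : Set} → (A → Value) → List A → Value
encodeList enc []       = nil
encodeList enc (x ∷ xs) = cons (enc x) (encodeList enc xs)

append-computes : ∀ {m n} (p : Subset m) (q : Subset n) →
  Computes appendᶠ (bits p ∷ bits q ∷ []) (bits (p ++ q)) (loopCost 0 m)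
append-computes [] q = finishᵉ (case-nilᵉ varᵉ varᵉ)
append-computes (a ∷ p) q = finishᵉ (case-consᵉ varᵉ
  (consᵉ varᵉ (callᵉ (varᵉ ∷ᵉ varᵉ ∷ᵉ []ᵉ) (append-computes p q))))

meets : ∀ {m n} → Subset m → Subset n → Bool
meets []          q           = false
meets (a ∷ p)     []          = false
meets (false ∷ p) (b ∷ q)     = meets p q
meets (true ∷ p)  (false ∷ q) = meets p q
meets (true ∷ p)  (true ∷ q)  = true

meets-computes : ∀ {m n} (p : Subset m) (q : Subset n) →
  Computes meetsᶠ (bits p ∷ bits q ∷ []) (encodeBool (meets p q)) (loopCost 0 m)
meets-computes [] q = finishᵉ (case-nilᵉ varᵉ nilᵉ)
meets-computes (a ∷ p) [] =
  finishᵉ (spareᵉ z≤n (case-consᵉ varᵉ (case-nilᵉ varᵉ nilᵉ)))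
meets-computes (false ∷ p) (b ∷ q) =
  finishᵉ (case-consᵉ varᵉ (case-consᵉ varᵉ (case-nilᵉ varᵉ
    (callᵉ (varᵉ ∷ᵉ varᵉ ∷ᵉ []ᵉ) (meets-computes p q)))))
meets-computes (true ∷ p) (false ∷ q) =
  finishᵉ (case-consᵉ varᵉ (case-consᵉ varᵉ (case-consᵉ varᵉ (case-nilᵉ varᵉ
    (callᵉ (varᵉ ∷ᵉ varᵉ ∷ᵉ []ᵉ) (meets-computes p q))))))
meets-computes (true ∷ p) (true ∷ q) =
  finishᵉ (spareᵉ z≤n (case-consᵉ varᵉ (case-consᵉ varᵉ (case-consᵉ varᵉ
    (case-consᵉ varᵉ (consᵉ nilᵉ nilᵉ))))))

loopCost-≥ : ∀ c k → overhead + 0 ≤ loopCost c k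
loopCost-≥ c zero    = ≤-refl
loopCost-≥ c (suc k) = +-monoʳ-≤ overhead z≤n

loopCost-mono : ∀ {c d k l} → c ≤ d → k ≤ l → loopCost c k ≤ loopCost d l
loopCost-mono {d = d} {l = l} c≤d z≤n       = loopCost-≥ d l
loopCost-mono                 c≤d (s≤s k≤l) =
  +-monoʳ-≤ overhead (+-mono-≤ (loopCost-mono c≤d k≤l) c≤d)

Key : ℕ → Set
Key m = Subset m × Subset m

encodeKey : ∀ {m} → Key m → Value
encodeKey (I , F) = cons (bits I) (bits F)

clash : ∀ {m n} → Key m → Key n → Bool
clash (I , F) (I′ , F′) = if meets F I′ then true else meets F′ I

clashCost : ℕ → ℕ → ℕ
clashCost m n = overhead + (loopCost 0 m + (loopCost 0 n + 0))

-- The payloads `x` and `y` are arbitrary, so that whole options and whole records can be passed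
-- instead of their keys.
clash-computes : ∀ {m n} (k : Key m) (l : Key n) {x y} →
  Computes clashᶠ (cons (encodeKey k) x ∷ cons (encodeKey l) y ∷ [])
    (encodeBool (clash k l)) (clashCost m n)
clash-computes (I , F) (I′ , F′) =
  finishᵉ (case-consᵉ varᵉ (case-consᵉ varᵉ (case-consᵉ varᵉ (case-consᵉ varᵉ
    (ifᵉ encodeBool
      (callᵉ (varᵉ ∷ᵉ varᵉ ∷ᵉ []ᵉ) (meets-computes F I′))
      (spareᵉ z≤n (consᵉ nilᵉ nilᵉ))
      (callᵉ (varᵉ ∷ᵉ varᵉ ∷ᵉ []ᵉ) (meets-computes F′ I)))))))

∪-computes : ∀ {n} (p q : Subset n) →
  Computes unionᶠ (bits p ∷ bits q ∷ []) (bits (p ∪ q)) (loopCost 0 n)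
∪-computes [] [] = finishᵉ (case-nilᵉ varᵉ nilᵉ)
∪-computes (true ∷ p) (b ∷ q) =
  finishᵉ (case-consᵉ varᵉ (case-consᵉ varᵉ (consᵉ
    (case-consᵉ varᵉ (consᵉ nilᵉ nilᵉ))
    (callᵉ (varᵉ ∷ᵉ varᵉ ∷ᵉ []ᵉ) (∪-computes p q)))))
∪-computes (false ∷ p) (b ∷ q) =
  finishᵉ (case-consᵉ varᵉ (case-consᵉ varᵉ (consᵉ (case-nilᵉ varᵉ varᵉ)
    (callᵉ (varᵉ ∷ᵉ varᵉ ∷ᵉ []ᵉ) (∪-computes p q)))))

-- Compares cardinalities without counting, by cancelling ones in pairs. Every step consumes a bit
-- of at least one argument, whence the depth `m + n` of the recursion.
leq : ∀ {m n} → Subset m → Subset n → Bool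
leq []          q           = true
leq (false ∷ p) q           = leq p q
leq (true ∷ p)  []          = false
leq (true ∷ p)  (false ∷ q) = leq (true ∷ p) q
leq (true ∷ p)  (true ∷ q)  = leq p q

leq-computes : ∀ {m n} (p : Subset m) (q : Subset n) →
  Computes leqᶠ (bits p ∷ bits q ∷ []) (encodeBool (leq p q)) (loopCost 0 (m + n))
leq-computes {n = n} [] q = Computes-≤ (loopCost-≥ 0 n)
  (finishᵉ (case-nilᵉ varᵉ (consᵉ nilᵉ nilᵉ)))
leq-computes (false ∷ p) q =
  finishᵉ (case-consᵉ varᵉ (case-nilᵉ varᵉ
    (callᵉ (varᵉ ∷ᵉ varᵉ ∷ᵉ []ᵉ) (leq-computes p q))))
leq-computes (true ∷ p) [] =
  finishᵉ (spareᵉ z≤n (case-consᵉ varᵉ (case-consᵉ varᵉ (case-nilᵉ varᵉ nilᵉ))))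
leq-computes {suc m} {suc n} (true ∷ p) (false ∷ q) =
  finishᵉ (case-consᵉ varᵉ (case-consᵉ varᵉ (case-consᵉ varᵉ (case-nilᵉ varᵉ
    (callᵉ (varᵉ ∷ᵉ varᵉ ∷ᵉ []ᵉ)
      (Computes-≤ (loopCost-mono z≤n (≤-reflexive (sym (+-suc m n))))
        (leq-computes (true ∷ p) q)))))))
leq-computes {suc m} {suc n} (true ∷ p) (true ∷ q) =
  finishᵉ (case-consᵉ varᵉ (case-consᵉ varᵉ (case-consᵉ varᵉ (case-consᵉ varᵉ
    (callᵉ (varᵉ ∷ᵉ varᵉ ∷ᵉ []ᵉ)
      (Computes-≤ (loopCost-mono z≤n (+-monoʳ-≤ m (n≤1+n n)))
        (leq-computes p q)))))))

triple : ∀ {n} → Subset n → Subset n → Subset n → Subset (n + (n + n))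
triple a b c = a ++ (b ++ c)

tripleCost : ℕ → ℕ
tripleCost n = overhead + (loopCost 0 n + (loopCost 0 n + 0))

triple-computes : ∀ {n} (a b c : Subset n) →
  Computes tripleᶠ (bits a ∷ bits b ∷ bits c ∷ []) (bits (triple a b c))
    (tripleCost n)
triple-computes a b c = finishᵉ
  (callᵉ (varᵉ ∷ᵉ callᵉ (varᵉ ∷ᵉ varᵉ ∷ᵉ []ᵉ) (append-computes b c) ∷ᵉ []ᵉ)
    (append-computes a (b ++ c)))

⊥-computes : ∀ {A : Set} (enc : A → Value) {n} (xs : Vec A n) →
  Computes zerosᶠ (encodeVec enc xs ∷ []) (bits (⊥ {n})) (loopCost 0 n)
⊥-computes enc []       = finishᵉ (case-nilᵉ varᵉ nilᵉ)
⊥-computes enc (x ∷ xs) = finishᵉ (case-consᵉ varᵉ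
  (consᵉ nilᵉ (callᵉ (varᵉ ∷ᵉ []ᵉ) (⊥-computes enc xs))))

shift-computes : ∀ {m n} (ps : Vec (Subset n) m) →
  Computes shiftᶠ (encodeVec bits ps ∷ [])
    (encodeVec bits (Vec.map (false ∷_) ps)) (loopCost 0 m)
shift-computes []       = finishᵉ (case-nilᵉ varᵉ nilᵉ)
shift-computes (p ∷ ps) = finishᵉ (case-consᵉ varᵉ
  (consᵉ (consᵉ nilᵉ varᵉ) (callᵉ (varᵉ ∷ᵉ []ᵉ) (shift-computes ps))))

-- m bounds the lengths of all the tails that the recursion visits.
⁅⁆-computes : ∀ {A : Set} (enc : A → Value) {m n} (xs : Vec A n) → n ≤ m →
  Computes unitsᶠ (encodeVec enc xs ∷ []) (encodeVec bits (tabulate {n = n} ⁅_⁆))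
    (loopCost (loopCost 0 m + (loopCost 0 m + 0)) n)
⁅⁆-computes enc []       n≤m = finishᵉ (case-nilᵉ varᵉ nilᵉ)
⁅⁆-computes enc {m} {suc n} (x ∷ xs) n<m = finishᵉ (case-consᵉ varᵉ
  (letinᵉ (callᵉ (varᵉ ∷ᵉ []ᵉ) (⁅⁆-computes enc xs n≤m))
    (consᵉ
      (consᵉ (consᵉ nilᵉ nilᵉ)
        (callᵉ (varᵉ ∷ᵉ []ᵉ) (Computes-≤ (loopCost-mono z≤n n≤m) (⊥-computes enc xs))))
      (callᵉ (varᵉ ∷ᵉ []ᵉ) (Computes-≤ (loopCost-mono z≤n n≤m)
        (Computes-≡ (cong (encodeVec bits) (sym (tabulate-∘ (false ∷_) ⁅_⁆)))
          (shift-computes (tabulate ⁅_⁆))))))))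
  where n≤m = ≤-trans (n≤1+n n) n<m

-- For `loopᶠ`, whose recursive call, of cost `d`, is evaluated last although `loopCost` counts it
-- first. The cost `b` of the branch taken is enlarged to the sum `c` over all three branches.
reorder : ∀ a {b c} d → b ≤ c → a + (b + (d + 0)) ≤ d + (a + c)
reorder a {b} {c} d b≤c = begin
  a + (b + (d + 0))  ≡⟨ lemma a b d ⟩
  d + (a + b)        ≤⟨ +-monoʳ-≤ d (+-monoʳ-≤ a b≤c) ⟩
  d + (a + c)        ∎
  where
  open ≤-Reasoning
  open +-*-Solver
  lemma : ∀ a b d → a + (b + (d + 0)) ≡ d + (a + b)
  lemma = solve 3 (λ a b d → a :+ (b :+ (d :+ con 0)) := d :+ (a :+ b)) refl

module Cost (n : ℕ) where

  -- Here `m` is the length of a key, `l` bounds the length of tables, and `n + (n + n)` is the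
  -- length of the key of a label.
  bestStep mergeStep absorbStep : ℕ → ℕ
  bestStep m   = clashCost m (n + (n + n)) + (loopCost 0 (n + n) + 0)
  mergeStep l  = loopCost (bestStep (n + (n + n))) l + (loopCost 0 n + 0)
  absorbStep l = clashCost n n + (loopCost (mergeStep l) l + 0)

  neighboursCost pointersStep recordsStep : ℕ
  neighboursCost = loopCost (clashCost n n + 0) n
  pointersStep   =
    tripleCost n + (tripleCost n + (tripleCost n + (tripleCost n + 0)))
  recordsStep    = tripleCost n + (tripleCost n + (loopCost pointersStep n + 0))

  isolatedCost leafCost rotateCost loopStep : ℕ → ℕ
  isolatedCost l = loopCost (bestStep 0) l + loopCost 0 n
  leafCost l     = loopCost (absorbStep l) n
  rotateCost l   = loopCost 0 n
  loopStep l     =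
    neighboursCost + (isolatedCost l + (leafCost l + rotateCost l))

  callsCost programCost : ℕ → ℕ → ℕ
  callsCost l j   = loopCost 0 n +
    (loopCost (loopCost 0 n + (loopCost 0 n + 0)) n +
    (loopCost recordsStep n + (loopCost (loopStep l) j + 0)))
  programCost l j = exprSize (Program.main minQuasiKernel) + callsCost l j

-- The elimination algorithm and its runs

module Algorithm {n : ℕ} (D : Digraph n) where

  open Cost n

  row : Fin n → Subset n
  row v = tabulate (D v)

  -- The constructors are the three kinds of labels in the order given above, w
  -- being the chosen out-neighbour.
  data Label (v : Fin n) : Set where
    inside : Label v
    one    : (w : Fin n) → .(Arc D v w) → Label v
    two    : (w : Fin n) → .(Arc D v w) → Label v

  -- The first component marks the vertex and the kind of its label; the second
  -- marks the pairs of a vertex and a kind that the label excludes.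
  labelKey : (v : Fin n) → Label v → Key (n + (n + n))
  labelKey v inside    = triple ⁅ v ⁆ ⊥ ⊥ , triple (row v) ⊥ ⊥
  labelKey v (one w _) = triple ⊥ ⁅ v ⁆ ⊥ , triple ⊥ ⁅ w ⁆ ⁅ w ⁆
  labelKey v (two w _) = triple ⊥ ⊥ ⁅ v ⁆ , triple ⁅ w ⁆ ⊥ ⁅ w ⁆

  -- Chosen so that two such keys clash exactly when there is an arc in one of the two directions.
  vertexKey : Fin n → Key n
  vertexKey v = ⁅ v ⁆ , row v

  adjacent : Fin n → Fin n → Bool
  adjacent v w = clash (vertexKey v) (vertexKey w)

  -- Each option comes with the part of the quasi-kernel that was fixed when
  -- vertices were absorbed.
  Table : Fin n → Set
  Table v = List (Label v × Subset n)

  Record : Set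
  Record = Σ (Fin n) Table

  encodeOption : ∀ {v} → Label v × Subset n → Value
  encodeOption {v} (x , q) = cons (encodeKey (labelKey v x)) (bits q)

  encodeTable : ∀ {v} → Table v → Value
  encodeTable = encodeList encodeOption

  encodeRecord : Record → Value
  encodeRecord (v , t) = cons (encodeKey (vertexKey v)) (encodeTable t)

  encodeRecords : List Record → Value
  encodeRecords = encodeList encodeRecord

  encodeMaybe : Maybe (Subset n) → Value
  encodeMaybe nothing  = nil
  encodeMaybe (just q) = cons (bits q) nil

  smaller : Subset n → Maybe (Subset n) → Maybe (Subset n)
  smaller q nothing   = just q
  smaller q (just q′) = if leq q q′ then just q else just q′

  best : ∀ {m v} → Key m → Table v → Maybe (Subset n)
  best         k []            = nothing
  best {v = v} k ((x , q) ∷ t) =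
    if clash k (labelKey v x) then best k t else smaller q (best k t)

  best-computes : ∀ {m v} (k : Key m) (t : Table v) {y} →
    Computes bestᶠ (cons (encodeKey k) y ∷ encodeTable t ∷ [])
      (encodeMaybe (best k t)) (loopCost (bestStep m) (List.length t))
  best-computes k [] = finishᵉ (case-nilᵉ varᵉ nilᵉ)
  best-computes {v = v} k ((x , q) ∷ t) with best k t | best-computes k t
  ... | nothing | ih = finishᵉ (case-consᵉ varᵉ
    (letinᵉ (callᵉ (varᵉ ∷ᵉ varᵉ ∷ᵉ []ᵉ) ih)
      (ifᵉ encodeMaybe
        (callᵉ (varᵉ ∷ᵉ varᵉ ∷ᵉ []ᵉ) (clash-computes k (labelKey v x)))
        (spareᵉ z≤n varᵉ)
        (spareᵉ z≤n
          (case-consᵉ varᵉ (case-nilᵉ varᵉ (consᵉ varᵉ nilᵉ)))))))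
  ... | just q′ | ih = finishᵉ (case-consᵉ varᵉ
    (letinᵉ (callᵉ (varᵉ ∷ᵉ varᵉ ∷ᵉ []ᵉ) ih)
      (ifᵉ encodeMaybe
        (callᵉ (varᵉ ∷ᵉ varᵉ ∷ᵉ []ᵉ) (clash-computes k (labelKey v x)))
        (spareᵉ z≤n varᵉ)
        (case-consᵉ varᵉ (case-consᵉ varᵉ
          (ifᵉ encodeMaybe
            (callᵉ (varᵉ ∷ᵉ varᵉ ∷ᵉ []ᵉ) (leq-computes q q′))
            (consᵉ varᵉ nilᵉ) varᵉ))))))

  merge : ∀ {v w} → Table v → Table w → Table v
  merge         []            t = []
  merge {v = v} ((x , q) ∷ s) t with best (labelKey v x) t
  ... | nothing = merge s t
  ... | just q′ = (x , q ∪ q′) ∷ merge s t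

  merge-computes : ∀ {v w} (s : Table v) (t : Table w) →
    Computes mergeᶠ (encodeTable s ∷ encodeTable t ∷ []) (encodeTable (merge s t))
      (loopCost (mergeStep (List.length t)) (List.length s))
  merge-computes [] t = finishᵉ (case-nilᵉ varᵉ nilᵉ)
  merge-computes {v = v} ((x , q) ∷ s) t
    with best (labelKey v x) t | best-computes (labelKey v x) t {bits q}
  ... | nothing | p = finishᵉ (case-consᵉ varᵉ
    (letinᵉ (callᵉ (varᵉ ∷ᵉ varᵉ ∷ᵉ []ᵉ) (merge-computes s t))
      (case-nilᵉ (callᵉ (varᵉ ∷ᵉ varᵉ ∷ᵉ []ᵉ) p) (spareᵉ z≤n varᵉ))))
  ... | just q′ | p = finishᵉ (case-consᵉ varᵉ
    (letinᵉ (callᵉ (varᵉ ∷ᵉ varᵉ ∷ᵉ []ᵉ) (merge-computes s t))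
      (case-consᵉ (callᵉ (varᵉ ∷ᵉ varᵉ ∷ᵉ []ᵉ) p) (case-consᵉ varᵉ
        (consᵉ
          (consᵉ varᵉ (callᵉ (varᵉ ∷ᵉ varᵉ ∷ᵉ []ᵉ) (∪-computes q q′)))
          varᵉ)))))

  neighbours : Fin n → List Record → List Record
  neighbours v []            = []
  neighbours v ((w , s) ∷ L) =
    if adjacent v w then (w , s) ∷ neighbours v L else neighbours v L

  neighbours-computes : ∀ v L {y} →
    Computes nbrsᶠ (cons (encodeKey (vertexKey v)) y ∷ encodeRecords L ∷ [])
      (encodeRecords (neighbours v L)) (loopCost (clashCost n n + 0) (List.length L))
  neighbours-computes v [] = finishᵉ (case-nilᵉ varᵉ nilᵉ)
  neighbours-computes v ((w , s) ∷ L) = finishᵉ (case-consᵉ varᵉ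
    (letinᵉ (callᵉ (varᵉ ∷ᵉ varᵉ ∷ᵉ []ᵉ) (neighbours-computes v L))
      (ifᵉ encodeRecords
        (callᵉ (varᵉ ∷ᵉ varᵉ ∷ᵉ []ᵉ) (clash-computes (vertexKey v) (vertexKey w)))
        (consᵉ varᵉ varᵉ) varᵉ)))

  absorb : Record → List Record → List Record
  absorb (v , t) []            = []
  absorb (v , t) ((w , s) ∷ L) =
    if adjacent v w then (w , merge s t) ∷ L else (w , s) ∷ absorb (v , t) L

  Small : ℕ → Record → Set
  Small l (v , t) = List.length t ≤ l

  absorb-computes : ∀ {l} v (t : Table v) L → Small l (v , t) →
    All (Small l) L →
    Computes absorbᶠ (encodeRecord (v , t) ∷ encodeRecords L ∷ [])
      (encodeRecords (absorb (v , t) L)) (loopCost (absorbStep l) (List.length L))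
  absorb-computes v t [] t≤ [] = finishᵉ (case-nilᵉ varᵉ nilᵉ)
  absorb-computes v t ((w , s) ∷ L) t≤ (s≤ ∷ L≤) = finishᵉ (case-consᵉ varᵉ
    (letinᵉ (callᵉ (varᵉ ∷ᵉ varᵉ ∷ᵉ []ᵉ) (absorb-computes v t L t≤ L≤))
      (ifᵉ encodeRecords
        (callᵉ (varᵉ ∷ᵉ varᵉ ∷ᵉ []ᵉ) (clash-computes (vertexKey v) (vertexKey w)))
        (case-consᵉ varᵉ (case-consᵉ varᵉ
          (consᵉ (consᵉ varᵉ (callᵉ (varᵉ ∷ᵉ varᵉ ∷ᵉ []ᵉ)
            (Computes-≤
              (loopCost-mono (+-monoˡ-≤ _ (loopCost-mono ≤-refl t≤)) s≤)
              (merge-computes s t)))) varᵉ)))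
        (spareᵉ z≤n (consᵉ varᵉ varᵉ)))))

  -- j bounds the number of iterations.  The key ([] , []) clashes with nothing,
  -- so that best ranges over the whole table.
  data Loop : ℕ → Subset n → List Record → Subset n → Set where
    done     : ∀ {j r} → Loop j r [] r
    isolated : ∀ {j r v t L q a} → neighbours v L ≡ [] →
               best {0} ([] , []) t ≡ just q → Loop j (r ∪ q) L a →
               Loop (suc j) r ((v , t) ∷ L) a
    leaf     : ∀ {j r v t L u a} → neighbours v L ≡ u ∷ [] →
               Loop j r (absorb (v , t) L) a → Loop (suc j) r ((v , t) ∷ L) a
    rotate   : ∀ {j r v t L u₁ u₂ us a} → neighbours v L ≡ u₁ ∷ u₂ ∷ us →
               Loop j r (L List.++ (v , t) ∷ []) a → Loop (suc j) r ((v , t) ∷ L) a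

  Loop-mono : ∀ {i j r L a} → i ≤ j → Loop i r L a → Loop j r L a
  Loop-mono i≤j       done             = done
  Loop-mono (s≤s i≤j) (isolated e b p) = isolated e b (Loop-mono i≤j p)
  Loop-mono (s≤s i≤j) (leaf e p)       = leaf e (Loop-mono i≤j p)
  Loop-mono (s≤s i≤j) (rotate e p)     = rotate e (Loop-mono i≤j p)

  merge-length : ∀ {v w} (s : Table v) (t : Table w) →
                 List.length (merge s t) ≤ List.length s
  merge-length [] t = z≤n
  merge-length {v = v} ((x , q) ∷ s) t with best (labelKey v x) t
  ... | nothing = m≤n⇒m≤1+n (merge-length s t)
  ... | just _  = s≤s (merge-length s t)

  absorb-length : ∀ r L → List.length (absorb r L) ≡ List.length L
  absorb-length r []            = refl
  absorb-length (v , t) ((w , s) ∷ L) with adjacent v w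
  ... | true  = refl
  ... | false = cong suc (absorb-length (v , t) L)

  absorb-small : ∀ {l} r L → All (Small l) L → All (Small l) (absorb r L)
  absorb-small r [] [] = []
  absorb-small (v , t) ((w , s) ∷ L) (s≤ ∷ L≤) with adjacent v w
  ... | true  = ≤-trans (merge-length s t) s≤ ∷ L≤
  ... | false = s≤ ∷ absorb-small (v , t) L L≤

  rotate-length : ∀ (r : Record) L →
                  List.length (L List.++ r ∷ []) ≡ suc (List.length L)
  rotate-length r L = trans (List.length-++ L) (+-comm (List.length L) 1)

  append-records-computes : ∀ K L →
    Computes appendᶠ (encodeRecords K ∷ encodeRecords L ∷ [])
      (encodeRecords (K List.++ L)) (loopCost 0 (List.length K))
  append-records-computes [] L = finishᵉ (case-nilᵉ varᵉ varᵉ)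
  append-records-computes (r ∷ K) L = finishᵉ (case-consᵉ varᵉ
    (consᵉ varᵉ (callᵉ (varᵉ ∷ᵉ varᵉ ∷ᵉ []ᵉ) (append-records-computes K L))))

  loop-computes : ∀ {j r L a l} → Loop j r L a → List.length L ≤ n →
    All (Small l) L →
    Computes loopᶠ (bits r ∷ encodeRecords L ∷ []) (bits a)
      (loopCost (loopStep l) j)
  loop-computes {j} done L≤ small =
    Computes-≤ (loopCost-≥ _ j) (finishᵉ (case-nilᵉ varᵉ varᵉ))
  loop-computes {suc j} {r} {(v , t) ∷ L} {l = l}
    (isolated {q = q} none eq p) L< (t≤ ∷ small) =
    Computes-≤ (+-monoʳ-≤ overhead (≤-trans
        (≤-reflexive (cong (neighboursCost +_)
          (sym (+-assoc (loopCost (bestStep 0) l) (loopCost 0 n)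
            (loopCost (loopStep l) j + 0)))))
        (reorder neighboursCost (loopCost (loopStep l) j) (m≤m+n (isolatedCost l) _))))
      (finishᵉ (case-consᵉ varᵉ (case-nilᵉ
        (callᵉ (varᵉ ∷ᵉ varᵉ ∷ᵉ []ᵉ)
          (Computes-≤ (loopCost-mono ≤-refl L≤)
            (Computes-≡ (cong encodeRecords none) (neighbours-computes v L))))
        (case-consᵉ varᵉ (case-consᵉ
          (callᵉ (consᵉ (consᵉ nilᵉ nilᵉ) nilᵉ ∷ᵉ varᵉ ∷ᵉ []ᵉ)
            (Computes-≤ (loopCost-mono ≤-refl t≤)
              (Computes-≡ (cong encodeMaybe eq) (best-computes {0} ([] , []) t))))
          (callᵉ (callᵉ (varᵉ ∷ᵉ varᵉ ∷ᵉ []ᵉ) (∪-computes r q) ∷ᵉ varᵉ ∷ᵉ []ᵉ)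
            (loop-computes p L≤ small)))))))
    where L≤ = ≤-trans (n≤1+n _) L<
  loop-computes {suc j} {r} {(v , t) ∷ L} {l = l}
    (leaf {u = u} single p) L< (t≤ ∷ small) =
    Computes-≤ (+-monoʳ-≤ overhead (reorder neighboursCost (loopCost (loopStep l) j)
        (≤-trans (m≤m+n (leafCost l) _) (m≤n+m _ (isolatedCost l)))))
      (finishᵉ (case-consᵉ varᵉ (case-consᵉ
        (callᵉ (varᵉ ∷ᵉ varᵉ ∷ᵉ []ᵉ)
          (Computes-≤ (loopCost-mono ≤-refl L≤)
            (Computes-≡ (cong encodeRecords single) (neighbours-computes v L))))
        (case-nilᵉ varᵉ
          (callᵉ (varᵉ ∷ᵉ callᵉ (varᵉ ∷ᵉ varᵉ ∷ᵉ []ᵉ)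
                (Computes-≤ (loopCost-mono ≤-refl L≤)
                  (absorb-computes v t L t≤ small)) ∷ᵉ []ᵉ)
            (loop-computes p
              (≤-trans (≤-reflexive (absorb-length (v , t) L)) L≤)
              (absorb-small (v , t) L small)))))))
    where L≤ = ≤-trans (n≤1+n _) L<
  loop-computes {suc j} {r} {(v , t) ∷ L} {l = l}
    (rotate {u₁ = u₁} several p) L< (t≤ ∷ small) =
    Computes-≤ (+-monoʳ-≤ overhead (reorder neighboursCost (loopCost (loopStep l) j)
        (≤-trans (m≤n+m (rotateCost l) (leafCost l)) (m≤n+m _ (isolatedCost l)))))
      (finishᵉ (case-consᵉ varᵉ (case-consᵉ
        (callᵉ (varᵉ ∷ᵉ varᵉ ∷ᵉ []ᵉ)
          (Computes-≤ (loopCost-mono ≤-refl L≤)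
            (Computes-≡ (cong encodeRecords several) (neighbours-computes v L))))
        (case-consᵉ varᵉ
          (callᵉ (varᵉ ∷ᵉ callᵉ (varᵉ ∷ᵉ consᵉ varᵉ nilᵉ ∷ᵉ []ᵉ)
                (Computes-≤ (loopCost-mono ≤-refl L≤)
                  (append-records-computes L ((v , t) ∷ []))) ∷ᵉ []ᵉ)
            (loop-computes p
              (≤-trans (≤-reflexive (rotate-length (v , t) L)) L<)
              (++⁺ small (t≤ ∷ []))))))))
    where L≤ = ≤-trans (n≤1+n _) L<

  -- The Boolean is an argument of its own, tied to `D v w` by an equation, so that proofs can split
  -- on it while the labels still obtain their arc.
  arcOptions : ∀ v w b → D v w ≡ b → Table v
  arcOptions v w true  eq =
    (one w (subst T (sym eq) tt) , ⊥) ∷ (two w (subst T (sym eq) tt) , ⊥) ∷ []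
  arcOptions v w false eq = []

  pointers : ∀ v {m} → (Fin m → Fin n) → Table v
  pointers v {zero}  f = []
  pointers v {suc m} f =
    arcOptions v (f zero) (D v (f zero)) refl List.++ pointers v (f ∘ suc)

  pointers-computes : ∀ v {m} (f : Fin m → Fin n) →
    Computes pointersᶠ
      (bits ⁅ v ⁆ ∷ bits (⊥ {n}) ∷ bits (tabulate (D v ∘ f)) ∷
       encodeVec bits (tabulate (⁅_⁆ ∘ f)) ∷ [])
      (encodeTable (pointers v f)) (loopCost pointersStep m)
  pointers-computes v {zero}  f = finishᵉ (case-nilᵉ varᵉ nilᵉ)
  pointers-computes v {suc m} f = step (D v w) refl
    where
    w = f zero

    step : ∀ b (eq : D v w ≡ b) →
      Computes pointersᶠ
        (bits ⁅ v ⁆ ∷ bits (⊥ {n}) ∷ bits (b ∷ tabulate (D v ∘ f ∘ suc)) ∷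
         encodeVec bits (tabulate (⁅_⁆ ∘ f)) ∷ [])
        (encodeTable (arcOptions v w b eq List.++ pointers v (f ∘ suc)))
        (loopCost pointersStep (suc m))
    step false eq = finishᵉ (case-consᵉ varᵉ (case-consᵉ varᵉ
      (letinᵉ (callᵉ (varᵉ ∷ᵉ varᵉ ∷ᵉ varᵉ ∷ᵉ varᵉ ∷ᵉ []ᵉ) (pointers-computes v (f ∘ suc)))
        (spareᵉ z≤n (case-nilᵉ varᵉ varᵉ)))))
    step true eq = finishᵉ (case-consᵉ varᵉ (case-consᵉ varᵉ
      (letinᵉ (callᵉ (varᵉ ∷ᵉ varᵉ ∷ᵉ varᵉ ∷ᵉ varᵉ ∷ᵉ []ᵉ) (pointers-computes v (f ∘ suc)))
        (case-consᵉ varᵉ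
          (consᵉ
            (consᵉ (consᵉ (callᵉ vars₃ (triple-computes ⊥ ⁅ v ⁆ ⊥))
                          (callᵉ vars₃ (triple-computes ⊥ ⁅ w ⁆ ⁅ w ⁆))) varᵉ)
            (consᵉ
              (consᵉ (consᵉ (callᵉ vars₃ (triple-computes ⊥ ⊥ ⁅ v ⁆))
                            (callᵉ vars₃ (triple-computes ⁅ w ⁆ ⊥ ⁅ w ⁆))) varᵉ)
              varᵉ))))))

  initialTable : ∀ v → Table v
  initialTable v = (inside , ⁅ v ⁆) ∷ pointers v (λ w → w)

  initialRecords : ∀ {m} → (Fin m → Fin n) → List Record
  initialRecords f = List.tabulate (λ i → f i , initialTable (f i))

  records-computes : ∀ {m} (f : Fin m → Fin n) →
    Computes recordsᶠ
      (bits (⊥ {n}) ∷ encodeVec bits (tabulate (row ∘ f)) ∷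
       encodeVec bits (tabulate (⁅_⁆ ∘ f)) ∷
       encodeVec bits (tabulate {n = n} ⁅_⁆) ∷ [])
      (encodeRecords (initialRecords f)) (loopCost recordsStep m)
  records-computes {zero}  f = finishᵉ (case-nilᵉ varᵉ nilᵉ)
  records-computes {suc m} f = finishᵉ (case-consᵉ varᵉ (case-consᵉ varᵉ
    (letinᵉ (callᵉ (varᵉ ∷ᵉ varᵉ ∷ᵉ varᵉ ∷ᵉ varᵉ ∷ᵉ []ᵉ) (records-computes (f ∘ suc)))
      (consᵉ
        (consᵉ (consᵉ varᵉ varᵉ)
          (consᵉ
            (consᵉ
              (consᵉ (callᵉ vars₃ (triple-computes ⁅ v ⁆ ⊥ ⊥))
                     (callᵉ vars₃ (triple-computes (row v) ⊥ ⊥)))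
              varᵉ)
            (callᵉ (varᵉ ∷ᵉ varᵉ ∷ᵉ varᵉ ∷ᵉ varᵉ ∷ᵉ []ᵉ)
              (pointers-computes v (λ w → w)))))
        varᵉ))))
    where v = f zero

  initial : List Record
  initial = initialRecords (λ v → v)

  program-runs : ∀ {j a l} → Loop j ⊥ initial a → All (Small l) initial →
    ∃[ t ] (Runs minQuasiKernel (encodeDigraph D) (bits a) t × t ≤ programCost l j)
  program-runs {j} {a} {l} p small =
    time , derivation , ≤-trans (m≤m+n time 0) bound
    where
    rows = tabulate row
    evaluation : encodeDigraph D ∷ [] ⊢ Program.main minQuasiKernel ⇓ bits a
                 [ callsCost l j ↝ 0 ]
    evaluation = letinᵉ (callᵉ (varᵉ ∷ᵉ []ᵉ) (⊥-computes bits rows))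
      (letinᵉ (callᵉ (varᵉ ∷ᵉ []ᵉ) (⁅⁆-computes bits rows ≤-refl))
        (callᵉ (varᵉ ∷ᵉ
            callᵉ (varᵉ ∷ᵉ varᵉ ∷ᵉ varᵉ ∷ᵉ varᵉ ∷ᵉ []ᵉ)
              (records-computes (λ v → v)) ∷ᵉ []ᵉ)
          (loop-computes p
            (≤-reflexive (List.length-tabulate (λ v → v , initialTable v)))
            small)))
    open _⊢_⇓_[_↝_] evaluation

-- Polynomial bounds

Polynomial : (ℕ → ℕ) → Set
Polynomial f = ∃[ c ] ∃[ d ] (∀ n → f n ≤ c * suc n ^ d)

const-poly : ∀ c → Polynomial (λ _ → c)
const-poly c = c , 0 , λ n → ≤-reflexive (sym (*-identityʳ c))

id-poly : Polynomial (λ n → n)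
id-poly = 1 , 1 , λ n → ≤-trans (n≤1+n n)
  (≤-reflexive (sym (trans (*-identityˡ _) (*-identityʳ (suc n)))))

infixl 6 _+ᵖ_
infixl 7 _*ᵖ_

-- The base `suc n` is positive, so powers are monotone in the exponent and `d + d′` can serve in
-- place of the maximum.
_+ᵖ_ : ∀ {f g} → Polynomial f → Polynomial g → Polynomial (λ n → f n + g n)
_+ᵖ_ {f} {g} (c , d , f≤) (c′ , d′ , g≤) = c + c′ , d + d′ , λ n →
  let open ≤-Reasoning in begin
  f n + g n
    ≤⟨ +-mono-≤ (f≤ n) (g≤ n) ⟩
  c * suc n ^ d + c′ * suc n ^ d′
    ≤⟨ +-mono-≤ (*-monoʳ-≤ c (^-monoʳ-≤ (suc n) (m≤m+n d d′)))
                (*-monoʳ-≤ c′ (^-monoʳ-≤ (suc n) (m≤n+m d′ d))) ⟩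
  c * suc n ^ (d + d′) + c′ * suc n ^ (d + d′)
    ≡⟨ *-distribʳ-+ (suc n ^ (d + d′)) c c′ ⟨
  (c + c′) * suc n ^ (d + d′)  ∎

_*ᵖ_ : ∀ {f g} → Polynomial f → Polynomial g → Polynomial (λ n → f n * g n)
_*ᵖ_ {f} {g} (c , d , f≤) (c′ , d′ , g≤) = c * c′ , d + d′ , λ n →
  let open ≤-Reasoning in begin
  f n * g n                          ≤⟨ *-mono-≤ (f≤ n) (g≤ n) ⟩
  c * suc n ^ d * (c′ * suc n ^ d′)  ≡⟨ [m*n]*[o*p]≡[m*o]*[n*p] c _ c′ _ ⟩
  c * c′ * (suc n ^ d * suc n ^ d′)  ≡⟨ cong (c * c′ *_) (^-distribˡ-+-* (suc n) d d′) ⟨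
  c * c′ * suc n ^ (d + d′)          ∎

loopCost-≤ : ∀ c k → loopCost c k ≤ suc k * (overhead + c)
loopCost-≤ c zero    = ≤-trans (+-monoʳ-≤ overhead z≤n) (m≤m+n (overhead + c) 0)
loopCost-≤ c (suc k) = begin
  overhead + (loopCost c k + c)  ≡⟨ cong (overhead +_) (+-comm (loopCost c k) c) ⟩
  overhead + (c + loopCost c k)  ≡⟨ +-assoc overhead c (loopCost c k) ⟨
  overhead + c + loopCost c k    ≤⟨ +-monoʳ-≤ (overhead + c) (loopCost-≤ c k) ⟩
  suc (suc k) * (overhead + c)   ∎
  where open ≤-Reasoning

loopCost-poly : ∀ {f g} → Polynomial f → Polynomial g →
                Polynomial (λ n → loopCost (f n) (g n))
loopCost-poly {f} {g} p q
  with c , d , bound ← (const-poly 1 +ᵖ q) *ᵖ (const-poly overhead +ᵖ p) =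
  c , d , λ n → ≤-trans (loopCost-≤ (f n) (g n)) (bound n)

-- A table starts with `inside` and two labels for each out-neighbour, and it never grows. Each of
-- the `n` eliminations takes at most `n` iterations, including the rotations before it.
tableBound roundBound : ℕ → ℕ
tableBound n = 1 + (n + n)
roundBound n = n * n

programCost-poly : Polynomial (λ n → Cost.programCost n (tableBound n) (roundBound n))
programCost-poly =
  const-poly (exprSize (Program.main minQuasiKernel)) +ᵖ (loop₀ +ᵖ
    (loopCost-poly (loop₀ +ᵖ (loop₀ +ᵖ const-poly 0)) id-poly +ᵖ
    (loopCost-poly recordsStep-poly id-poly +ᵖ
    (loopCost-poly loopStep-poly (id-poly *ᵖ id-poly) +ᵖ const-poly 0))))
  where
  -- Three times `n`, the length of the key of a label, not a cube.
  n³ : Polynomial (λ n → n + (n + n))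
  n³ = id-poly +ᵖ (id-poly +ᵖ id-poly)

  l-poly : Polynomial tableBound
  l-poly = const-poly 1 +ᵖ (id-poly +ᵖ id-poly)

  loop₀ : Polynomial (λ n → loopCost 0 n)
  loop₀ = loopCost-poly (const-poly 0) id-poly

  clash-poly : ∀ {f g} → Polynomial f → Polynomial g →
               Polynomial (λ n → clashCost (f n) (g n))
  clash-poly p q = const-poly overhead +ᵖ (loopCost-poly (const-poly 0) p +ᵖ
    (loopCost-poly (const-poly 0) q +ᵖ const-poly 0))

  bestStep-poly : ∀ {f} → Polynomial f → Polynomial (λ n → Cost.bestStep n (f n))
  bestStep-poly p = clash-poly p n³ +ᵖ
    (loopCost-poly (const-poly 0) (id-poly +ᵖ id-poly) +ᵖ const-poly 0)

  triple-poly : Polynomial tripleCost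
  triple-poly = const-poly overhead +ᵖ (loop₀ +ᵖ (loop₀ +ᵖ const-poly 0))

  recordsStep-poly : Polynomial Cost.recordsStep
  recordsStep-poly = triple-poly +ᵖ (triple-poly +ᵖ
    (loopCost-poly (triple-poly +ᵖ (triple-poly +ᵖ (triple-poly +ᵖ
      (triple-poly +ᵖ const-poly 0)))) id-poly +ᵖ const-poly 0))

  absorbStep-poly : Polynomial (λ n → Cost.absorbStep n (tableBound n))
  absorbStep-poly = clash-poly id-poly id-poly +ᵖ
    (loopCost-poly (loopCost-poly (bestStep-poly n³) l-poly +ᵖ (loop₀ +ᵖ const-poly 0))
      l-poly +ᵖ const-poly 0)

  loopStep-poly : Polynomial (λ n → Cost.loopStep n (tableBound n))
  loopStep-poly =
    loopCost-poly (clash-poly id-poly id-poly +ᵖ const-poly 0) id-poly +ᵖ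
    ((loopCost-poly (bestStep-poly (const-poly 0)) l-poly +ᵖ loop₀) +ᵖ
    (loopCost-poly absorbStep-poly id-poly +ᵖ loop₀))

-- Elimination of leaves

meets-++ : ∀ {k m} (p p′ : Subset k) (q q′ : Subset m) →
           meets (p ++ q) (p′ ++ q′) ≡ meets p p′ ∨ meets q q′
meets-++ []          []           q q′ = refl
meets-++ (false ∷ p) (b ∷ p′)     q q′ = meets-++ p p′ q q′
meets-++ (true ∷ p)  (false ∷ p′) q q′ = meets-++ p p′ q q′
meets-++ (true ∷ p)  (true ∷ p′)  q q′ = refl

meets-⊥ : ∀ {n} (p : Subset n) → meets p (⊥ {n}) ≡ false
meets-⊥ []          = refl
meets-⊥ (false ∷ p) = meets-⊥ p
meets-⊥ (true ∷ p)  = meets-⊥ p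

meets-[] : ∀ {n} (p : Subset n) → meets p [] ≡ false
meets-[] []      = refl
meets-[] (_ ∷ _) = refl

meets-⁅⁆ : ∀ {n} (p : Subset n) (v : Fin n) → meets p ⁅ v ⁆ ≡ lookup p v
meets-⁅⁆ (false ∷ p) zero    = meets-⊥ p
meets-⁅⁆ (true ∷ p)  zero    = refl
meets-⁅⁆ (false ∷ p) (suc v) = meets-⁅⁆ p v
meets-⁅⁆ (true ∷ p)  (suc v) = meets-⁅⁆ p v

module _ {n : ℕ} (a b c : Subset n) (v : Fin n) where

  meets-triple : ∀ a′ b′ c′ → meets (triple a b c) (triple a′ b′ c′) ≡
                 meets a a′ ∨ (meets b b′ ∨ meets c c′)
  meets-triple a′ b′ c′ = trans (meets-++ a a′ (b ++ c) (b′ ++ c′))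
    (cong (meets a a′ ∨_) (meets-++ b b′ c c′))

  meets-triple₀ : meets (triple a b c) (triple ⁅ v ⁆ ⊥ ⊥) ≡ lookup a v
  meets-triple₀ rewrite meets-triple ⁅ v ⁆ ⊥ ⊥ | meets-⊥ b | meets-⊥ c =
    trans (∨-identityʳ _) (meets-⁅⁆ a v)

  meets-triple₁ : meets (triple a b c) (triple ⊥ ⁅ v ⁆ ⊥) ≡ lookup b v
  meets-triple₁ rewrite meets-triple ⊥ ⁅ v ⁆ ⊥ | meets-⊥ a | meets-⊥ c =
    trans (∨-identityʳ _) (meets-⁅⁆ b v)

  meets-triple₂ : meets (triple a b c) (triple ⊥ ⊥ ⁅ v ⁆) ≡ lookup c v
  meets-triple₂ rewrite meets-triple ⊥ ⊥ ⁅ v ⁆ | meets-⊥ a | meets-⊥ b =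
    meets-⁅⁆ c v

lookup-⁅⁆ : ∀ {n} {u w : Fin n} → lookup ⁅ u ⁆ w ≡ true → w ≡ u
lookup-⁅⁆ {u = u} {w} eq = x∈⁅y⁆⇒x≡y u (lookup⇒[]= w ⁅ u ⁆ eq)

if-false : ∀ a {b} → (if a then true else b) ≡ false → a ≡ false × b ≡ false
if-false false eq = refl , eq

clash-sym : ∀ {m n} (k : Key m) (l : Key n) → clash k l ≡ clash l k
clash-sym (I , F) (I′ , F′) with meets F I′ | meets F′ I
... | true  | true  = refl
... | true  | false = refl
... | false | true  = refl
... | false | false = refl

leq-true : ∀ {m n} (p : Subset m) (q : Subset n) → leq p q ≡ true → ∣ p ∣ ≤ ∣ q ∣
leq-true []          q           eq = z≤n
leq-true (false ∷ p) q           eq = leq-true p q eq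
leq-true (true ∷ p)  (false ∷ q) eq = leq-true (true ∷ p) q eq
leq-true (true ∷ p)  (true ∷ q)  eq = s≤s (leq-true p q eq)

leq-false : ∀ {m n} (p : Subset m) (q : Subset n) → leq p q ≡ false → ∣ q ∣ ≤ ∣ p ∣
leq-false (false ∷ p) q           eq = leq-false p q eq
leq-false (true ∷ p)  []          eq = z≤n
leq-false (true ∷ p)  (false ∷ q) eq = leq-false (true ∷ p) q eq
leq-false (true ∷ p)  (true ∷ q)  eq = s≤s (leq-false p q eq)

∣p∪q∣≤∣p∣+∣q∣ : ∀ {n} (p q : Subset n) → ∣ p ∪ q ∣ ≤ ∣ p ∣ + ∣ q ∣
∣p∪q∣≤∣p∣+∣q∣ []          []          = z≤n
∣p∪q∣≤∣p∣+∣q∣ (false ∷ p) (false ∷ q) = ∣p∪q∣≤∣p∣+∣q∣ p q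
∣p∪q∣≤∣p∣+∣q∣ (false ∷ p) (true ∷ q)  =
  ≤-trans (s≤s (∣p∪q∣≤∣p∣+∣q∣ p q)) (≤-reflexive (sym (+-suc ∣ p ∣ ∣ q ∣)))
∣p∪q∣≤∣p∣+∣q∣ (true ∷ p)  (false ∷ q) = s≤s (∣p∪q∣≤∣p∣+∣q∣ p q)
∣p∪q∣≤∣p∣+∣q∣ (true ∷ p)  (true ∷ q)  = s≤s
  (≤-trans (∣p∪q∣≤∣p∣+∣q∣ p q) (+-monoʳ-≤ ∣ p ∣ (n≤1+n ∣ q ∣)))

module Elimination {n : ℕ} (D : Digraph n) where

  open Algorithm D

  -- The constraints behind the keys. A pointer demands a kind of its target by excluding the other
  -- two kinds there: the target of `one` has to be `inside`, that of `two` has to carry `one`.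
  excludes : ∀ {v w} → Label v → Label w → Bool
  excludes {v} {w} inside    inside    = D v w
  excludes         inside    (one _ _) = false
  excludes         inside    (two _ _) = false
  excludes         (one u _) inside    = false
  excludes {v} {w} (one u _) (one _ _) = lookup ⁅ u ⁆ w
  excludes {v} {w} (one u _) (two _ _) = lookup ⁅ u ⁆ w
  excludes {v} {w} (two u _) inside    = lookup ⁅ u ⁆ w
  excludes         (two u _) (one _ _) = false
  excludes {v} {w} (two u _) (two _ _) = lookup ⁅ u ⁆ w

  meets-labelKey : ∀ {v w} (x : Label v) (y : Label w) →
    meets (proj₂ (labelKey v x)) (proj₁ (labelKey w y)) ≡ excludes x y
  meets-labelKey {v} {w} inside inside =
    trans (meets-triple₀ (row v) ⊥ ⊥ w) (lookup∘tabulate (D v) w)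
  meets-labelKey {v} {w} inside (one _ _) =
    trans (meets-triple₁ (row v) ⊥ ⊥ w) (lookup-replicate w false)
  meets-labelKey {v} {w} inside (two _ _) =
    trans (meets-triple₂ (row v) ⊥ ⊥ w) (lookup-replicate w false)
  meets-labelKey {v} {w} (one u _) inside =
    trans (meets-triple₀ ⊥ ⁅ u ⁆ ⁅ u ⁆ w) (lookup-replicate w false)
  meets-labelKey {v} {w} (one u _) (one _ _) = meets-triple₁ ⊥ ⁅ u ⁆ ⁅ u ⁆ w
  meets-labelKey {v} {w} (one u _) (two _ _) = meets-triple₂ ⊥ ⁅ u ⁆ ⁅ u ⁆ w
  meets-labelKey {v} {w} (two u _) inside    = meets-triple₀ ⁅ u ⁆ ⊥ ⁅ u ⁆ w
  meets-labelKey {v} {w} (two u _) (one _ _) =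
    trans (meets-triple₁ ⁅ u ⁆ ⊥ ⁅ u ⁆ w) (lookup-replicate w false)
  meets-labelKey {v} {w} (two u _) (two _ _) = meets-triple₂ ⁅ u ⁆ ⊥ ⁅ u ⁆ w

  Choice : Set
  Choice = Σ (Fin n) Label

  -- A record instead of the bare equation, so that unification can recover the two choices.
  record Compatible (c d : Choice) : Set where
    constructor compatible
    field clash-free :
            clash (uncurry labelKey c) (uncurry labelKey d) ≡ false

  open Compatible

  compatible-sym : ∀ {c d} → Compatible c d → Compatible d c
  compatible-sym {v , x} {w , y} (compatible p) =
    compatible (trans (clash-sym (labelKey w y) (labelKey v x)) p)

  compatible⁻ : ∀ {v w} {x : Label v} {y : Label w} →
    Compatible (v , x) (w , y) → excludes x y ≡ false × excludes y x ≡ false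
  compatible⁻ {x = x} {y} (compatible c) with p , q ← if-false _ c =
    trans (sym (meets-labelKey x y)) p , trans (sym (meets-labelKey y x)) q

  compatible⁺ : ∀ {v w} {x : Label v} {y : Label w} →
    excludes x y ≡ false → excludes y x ≡ false → Compatible (v , x) (w , y)
  compatible⁺ {v} {w} {x} {y} p q = compatible unclashed
    where
    unclashed : clash (labelKey v x) (labelKey w y) ≡ false
    unclashed rewrite meets-labelKey x y | p | meets-labelKey y x | q = refl

  adjacent⁻ : ∀ v w → adjacent v w ≡ false → D v w ≡ false × D w v ≡ false
  adjacent⁻ v w eq with p , q ← if-false _ eq =
    trans (sym (lookup∘tabulate (D v) w)) (trans (sym (meets-⁅⁆ (row v) w)) p) ,
    trans (sym (lookup∘tabulate (D w) v)) (trans (sym (meets-⁅⁆ (row w) v)) q)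

  pointer-excludes : ∀ {v w} u → .(Arc D v u) → D v w ≡ false →
                     lookup ⁅ u ⁆ w ≡ false
  pointer-excludes {v} {w} u arc eq with lookup ⁅ u ⁆ w in hit
  ... | false = refl
  ... | true with refl ← lookup-⁅⁆ {u = u} {w} hit = absurd eq arc
    where
    absurd : ∀ {b} → b ≡ false → .(T b) → true ≡ false
    absurd refl ()

  -- Pointers follow arcs, so a label of `v` excludes something only at out-neighbours of `v`.
  nonadjacent-excludes : ∀ {v w} (x : Label v) (y : Label w) → D v w ≡ false →
                         excludes x y ≡ false
  nonadjacent-excludes inside    inside    eq = eq
  nonadjacent-excludes inside    (one _ _) eq = refl
  nonadjacent-excludes inside    (two _ _) eq = refl
  nonadjacent-excludes (one u p) inside    eq = refl
  nonadjacent-excludes (one u p) (one _ _) eq = pointer-excludes u p eq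
  nonadjacent-excludes (one u p) (two _ _) eq = pointer-excludes u p eq
  nonadjacent-excludes (two u p) inside    eq = pointer-excludes u p eq
  nonadjacent-excludes (two u p) (one _ _) eq = refl
  nonadjacent-excludes (two u p) (two _ _) eq = pointer-excludes u p eq

  nonadjacent-compatible : ∀ {v w} (x : Label v) (y : Label w) →
    adjacent v w ≡ false → Compatible (v , x) (w , y)
  nonadjacent-compatible {v} {w} x y eq with p , q ← adjacent⁻ v w eq =
    compatible⁺ {x = x} {y} (nonadjacent-excludes x y p) (nonadjacent-excludes y x q)

  best-just : ∀ {m v} (k : Key m) (t : Table v) {q} → best k t ≡ just q →
    ∃[ x ] ((x , q) ∈ˡ t × clash k (labelKey v x) ≡ false)
  best-just {v = v} k ((x , p) ∷ t) eq with clash k (labelKey v x) in c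
  ... | true with y , y∈t , d ← best-just k t eq = y , there y∈t , d
  ... | false with best k t in b
  ...   | nothing with refl ← eq = x , here refl , c
  ...   | just q′ with leq p q′ | eq
  ...     | true  | refl = x , here refl , c
  ...     | false | refl with y , y∈t , d ← best-just k t b = y , there y∈t , d

  smaller-≤ˡ : ∀ p r → ∃[ q ] (smaller p r ≡ just q × ∣ q ∣ ≤ ∣ p ∣)
  smaller-≤ˡ p nothing = p , refl , ≤-refl
  smaller-≤ˡ p (just q) with leq p q in eq
  ... | true  = p , refl , ≤-refl
  ... | false = q , refl , leq-false p q eq

  smaller-≤ʳ : ∀ p {r q} → r ≡ just q → ∃[ q′ ] (smaller p r ≡ just q′ × ∣ q′ ∣ ≤ ∣ q ∣)
  smaller-≤ʳ p {q = q} refl with leq p q in eq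
  ... | true  = p , refl , leq-true p q eq
  ... | false = q , refl , ≤-refl

  best-minimal : ∀ {m v} (k : Key m) (t : Table v) {x q} → (x , q) ∈ˡ t →
    clash k (labelKey v x) ≡ false → ∃[ q′ ] (best k t ≡ just q′ × ∣ q′ ∣ ≤ ∣ q ∣)
  best-minimal k ((x , q) ∷ t) (here refl) c rewrite c = smaller-≤ˡ q (best k t)
  best-minimal {v = v} k ((y , p) ∷ t) (there i) c
    with q′ , eq , q′≤ ← best-minimal k t i c with clash k (labelKey v y)
  ... | true = q′ , eq , q′≤
  ... | false with q″ , eq′ , q″≤ ← smaller-≤ʳ p eq = q″ , eq′ , ≤-trans q″≤ q′≤

  merge-∈⁻ : ∀ {v w} (s : Table v) (t : Table w) {x p} → (x , p) ∈ˡ merge s t →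
    ∃[ q ] ∃[ y ] ∃[ r ] ((x , q) ∈ˡ s × (y , r) ∈ˡ t ×
      Compatible (v , x) (w , y) × p ≡ q ∪ r)
  merge-∈⁻ {v} ((x , q) ∷ s) t i with best (labelKey v x) t in eq | i
  ... | nothing | i with q′ , y , r , j , k , c , e ← merge-∈⁻ s t i =
    q′ , y , r , there j , k , c , e
  ... | just r | here refl with y , j , c ← best-just (labelKey v x) t eq =
    q , y , r , here refl , j , compatible c , refl
  ... | just _ | there i with q′ , y , r , j , k , c , e ← merge-∈⁻ s t i =
    q′ , y , r , there j , k , c , e

  merge-∈⁺ : ∀ {v w} (s : Table v) (t : Table w) {x q y r} →
    (x , q) ∈ˡ s → (y , r) ∈ˡ t → Compatible (v , x) (w , y) →
    ∃[ r′ ] ((x , q ∪ r′) ∈ˡ merge s t × ∣ r′ ∣ ≤ ∣ r ∣)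
  merge-∈⁺ {v} ((x , q) ∷ s) t (here refl) j c
    with r′ , eq , r′≤ ← best-minimal (labelKey v x) t j (clash-free c) rewrite eq =
    r′ , here refl , r′≤
  merge-∈⁺ {v} ((x , q) ∷ s) t (there i) j c
    with r′ , k , r′≤ ← merge-∈⁺ s t i j c with best (labelKey v x) t
  ... | nothing = r′ , k , r′≤
  ... | just _  = r′ , there k , r′≤

  -- Solutions and their preservation under the steps of the loop

  data Solution : List Record → List Choice → List (Subset n) → Set where
    []  : Solution [] [] []
    _∷_ : ∀ {v t L x q cs qs} → (x , q) ∈ˡ t × All (Compatible (v , x)) cs →
          Solution L cs qs → Solution ((v , t) ∷ L) ((v , x) ∷ cs) (q ∷ qs)

  -- Merging drops labels that have no compatible partner, so a table could become empty.
  -- Feasibility survives every step and ensures that `best` finds an option for an isolated vertex.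
  Feasible : List Record → Set
  Feasible L = ∃[ cs ] ∃[ qs ] Solution L cs qs

  ⋃ : List (Subset n) → Subset n
  ⋃ = foldr _∪_ ⊥

  total : List (Subset n) → ℕ
  total qs = sum (map ∣_∣ qs)

  -- The answer is a union, but it is compared with sums of sizes. As a union is never larger than
  -- the sum, no disjointness has to be maintained; nothing is lost in the end, because the solution
  -- coming from a quasi-kernel `Q` has total exactly `∣ Q ∣`.
  record Optimum (r : Subset n) (L : List Record) (a : Subset n) : Set where
    field
      attained : ∃[ cs ] ∃[ qs ] (Solution L cs qs × a ≡ r ∪ ⋃ qs)
      minimal  : ∀ {cs qs} → Solution L cs qs → ∣ a ∣ ≤ ∣ r ∣ + total qs

  Solved : ℕ → Subset n → List Record → Set
  Solved j r L = ∃[ a ] (Loop j r L a × Optimum r L a)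

  isolated-compatible : ∀ v L → neighbours v L ≡ [] → ∀ x {cs qs} →
    Solution L cs qs → All (Compatible (v , x)) cs
  isolated-compatible v [] none x [] = []
  isolated-compatible v ((w , s) ∷ L) none x (_∷_ {x = y} (i , cs) sol)
    with adjacent v w in eq
  ... | false =
    nonadjacent-compatible x y eq ∷ isolated-compatible v L none x sol

  best-overall : ∀ {v} {t : Table v} {x p q} → (x , p) ∈ˡ t →
    best {0} ([] , []) t ≡ just q → ∣ q ∣ ≤ ∣ p ∣
  best-overall {v} {t} {x} i eq
    with q , eq′ , q≤ ← best-minimal {0} ([] , []) t i (meets-[] (proj₂ (labelKey v x)))
    with refl ← trans (sym eq) eq′ = q≤

  isolated-solved : ∀ {j r v t L} → neighbours v L ≡ [] →
    Feasible ((v , t) ∷ L) → (∀ r → Solved j r L) → Solved (suc j) r ((v , t) ∷ L)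
  isolated-solved {r = r} {v} {t} {L} none (_ , _ , _∷_ {x = y} (i , _) _) solve
    with q , eq , _ ← best-minimal {0} ([] , []) t i (meets-[] (proj₂ (labelKey v y)))
    with x , j , _ ← best-just {0} ([] , []) t eq
    with a , p , opt ← solve (r ∪ q) = a , isolated none eq p , record
      { attained = let cs , qs , sol , e = Optimum.attained opt in
          _ , _ , (j , isolated-compatible v L none x sol) ∷ sol ,
          trans e (∪-assoc r q (⋃ qs))
      ; minimal = λ where
          (_∷_ {q = p} {qs = qs} (i′ , _) sol) → let open ≤-Reasoning in begin
            ∣ a ∣                     ≤⟨ Optimum.minimal opt sol ⟩
            ∣ r ∪ q ∣ + total qs      ≤⟨ +-monoˡ-≤ _ (∣p∪q∣≤∣p∣+∣q∣ r q) ⟩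
            ∣ r ∣ + ∣ q ∣ + total qs  ≤⟨ +-monoˡ-≤ _ (+-monoʳ-≤ ∣ r ∣ (best-overall i′ eq)) ⟩
            ∣ r ∣ + ∣ p ∣ + total qs  ≡⟨ +-assoc ∣ r ∣ ∣ p ∣ (total qs) ⟩
            ∣ r ∣ + total (p ∷ qs)    ∎
      }

  -- A merged option of the neighbour arose from one of its old options and a compatible option of
  -- `v`. Separating the two regroups the union without changing it.
  absorb-solution⁻ : ∀ v t L {u} → neighbours v L ≡ u ∷ [] → ∀ {cs qs} →
    Solution (absorb (v , t) L) cs qs →
    ∃[ x ] ∃[ q ] ∃[ ps ] ((x , q) ∈ˡ t × All (Compatible (v , x)) cs ×
      Solution L cs ps × ⋃ (q ∷ ps) ≡ ⋃ qs)
  absorb-solution⁻ v t ((w , s) ∷ L) single sol with adjacent v w in eq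
  absorb-solution⁻ v t ((w , s) ∷ L) single {qs = _ ∷ qs} ((i , cs) ∷ sol) | true
    with q , x , r , i′ , j , c , refl ← merge-∈⁻ s t i =
    x , r , q ∷ qs , j ,
    -- By `single`, no neighbour of `v` follows `w`, so the rest does not restrict `x`.
    compatible-sym c ∷ isolated-compatible v L (List.∷-injectiveʳ single) x sol ,
    (i′ , cs) ∷ sol ,
    trans (sym (∪-assoc r q (⋃ qs))) (cong (_∪ ⋃ qs) (∪-comm r q))
  absorb-solution⁻ v t ((w , s) ∷ L) single {qs = p ∷ qs}
    (_∷_ {x = y} (i , cs) sol) | false
    with x , q , ps , j , ds , sol′ , e ← absorb-solution⁻ v t L single sol =
    x , q , p ∷ ps , j , nonadjacent-compatible x y eq ∷ ds , (i , cs) ∷ sol′ ,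
    (begin
      q ∪ (p ∪ ⋃ ps)  ≡⟨ ∪-assoc q p (⋃ ps) ⟨
      (q ∪ p) ∪ ⋃ ps    ≡⟨ cong (_∪ ⋃ ps) (∪-comm q p) ⟩
      (p ∪ q) ∪ ⋃ ps    ≡⟨ ∪-assoc p q (⋃ ps) ⟩
      p ∪ (q ∪ ⋃ ps)  ≡⟨ cong (p ∪_) e ⟩
      p ∪ ⋃ qs        ∎)
    where open ≡-Reasoning

  -- The set that is merged in may differ from `q`, but it belongs to the cheapest compatible option
  -- and is thus no larger.
  absorb-solution⁺ : ∀ v t L {u} → neighbours v L ≡ u ∷ [] → ∀ {x q cs qs} →
    (x , q) ∈ˡ t → All (Compatible (v , x)) cs → Solution L cs qs →
    ∃[ ps ] (Solution (absorb (v , t) L) cs ps × total ps ≤ ∣ q ∣ + total qs)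
  absorb-solution⁺ v t ((w , s) ∷ L) single {q = q} {qs = p ∷ qs} j (d ∷ ds)
    ((i , cs) ∷ sol) with adjacent v w
  ... | true with r , k , r≤ ← merge-∈⁺ s t i j (compatible-sym d) =
    p ∪ r ∷ qs , (k , cs) ∷ sol , (begin
      ∣ p ∪ r ∣ + total qs        ≤⟨ +-monoˡ-≤ _ (∣p∪q∣≤∣p∣+∣q∣ p r) ⟩
      ∣ p ∣ + ∣ r ∣ + total qs    ≤⟨ +-monoˡ-≤ _ (+-monoʳ-≤ ∣ p ∣ r≤) ⟩
      ∣ p ∣ + ∣ q ∣ + total qs    ≡⟨ cong (_+ total qs) (+-comm ∣ p ∣ ∣ q ∣) ⟩
      ∣ q ∣ + ∣ p ∣ + total qs    ≡⟨ +-assoc ∣ q ∣ ∣ p ∣ (total qs) ⟩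
      ∣ q ∣ + (∣ p ∣ + total qs)  ∎)
    where open ≤-Reasoning
  ... | false with ps , sol′ , ps≤ ← absorb-solution⁺ v t L single j ds sol =
    p ∷ ps , (i , cs) ∷ sol′ , (begin
      ∣ p ∣ + total ps            ≤⟨ +-monoʳ-≤ ∣ p ∣ ps≤ ⟩
      ∣ p ∣ + (∣ q ∣ + total qs)  ≡⟨ +-assoc ∣ p ∣ ∣ q ∣ (total qs) ⟨
      ∣ p ∣ + ∣ q ∣ + total qs    ≡⟨ cong (_+ total qs) (+-comm ∣ p ∣ ∣ q ∣) ⟩
      ∣ q ∣ + ∣ p ∣ + total qs    ≡⟨ +-assoc ∣ q ∣ ∣ p ∣ (total qs) ⟩
      ∣ q ∣ + (∣ p ∣ + total qs)  ∎)
    where open ≤-Reasoning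

  absorb-feasible : ∀ {v t L u} → neighbours v L ≡ u ∷ [] →
    Feasible ((v , t) ∷ L) → Feasible (absorb (v , t) L)
  absorb-feasible single (_ , _ , (i , ds) ∷ sol)
    with _ , sol′ , _ ← absorb-solution⁺ _ _ _ single i ds sol = _ , _ , sol′

  leaf-solved : ∀ {j r v t L u} → neighbours v L ≡ u ∷ [] →
    Solved j r (absorb (v , t) L) → Solved (suc j) r ((v , t) ∷ L)
  leaf-solved {r = r} {v} {t} {L} single (a , p , opt) = a , leaf single p , record
    { attained =
        let cs , qs , sol , e = Optimum.attained opt
            x , q , ps , i , ds , sol′ , e′ = absorb-solution⁻ v t L single sol
        in _ , _ , (i , ds) ∷ sol′ , trans e (cong (r ∪_) (sym e′))
    ; minimal = λ where
        ((i , ds) ∷ sol) →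
          let ps , sol′ , ps≤ = absorb-solution⁺ v t L single i ds sol
          in ≤-trans (Optimum.minimal opt sol′) (+-monoʳ-≤ ∣ r ∣ ps≤)
    }

  rotate-solution⁺ : ∀ {v t} L {x q cs qs} → (x , q) ∈ˡ t →
    All (Compatible (v , x)) cs → Solution L cs qs →
    Solution (L List.++ (v , t) ∷ []) (cs List.++ (v , x) ∷ []) (qs List.++ q ∷ [])
  rotate-solution⁺ [] i [] [] = (i , []) ∷ []
  rotate-solution⁺ (_ ∷ L) i (d ∷ ds) ((j , cs) ∷ sol) =
    (j , ++⁺ cs (compatible-sym d ∷ [])) ∷ rotate-solution⁺ L i ds sol

  rotate-solution⁻ : ∀ {v t} L {cs qs} → Solution (L List.++ (v , t) ∷ []) cs qs →
    ∃[ x ] ∃[ q ] ∃[ ds ] ∃[ ps ] (Solution ((v , t) ∷ L) ((v , x) ∷ ds) (q ∷ ps) ×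
      cs ≡ ds List.++ (v , x) ∷ [] × qs ≡ ps List.++ q ∷ [])
  rotate-solution⁻ [] ((i , []) ∷ []) = _ , _ , [] , [] , (i , []) ∷ [] , refl , refl
  rotate-solution⁻ (_ ∷ L) ((j , cs) ∷ sol)
    with x , q , ds , ps , (i , es) ∷ sol′ , refl , refl ← rotate-solution⁻ L sol
    with d ∷ [] ← All.++⁻ʳ ds cs =
    x , q , _ ∷ ds , _ ∷ ps ,
    (i , compatible-sym d ∷ es) ∷ (j , All.++⁻ˡ ds cs) ∷ sol′ , refl , refl

  ⋃-snoc : ∀ qs q → ⋃ (qs List.++ q ∷ []) ≡ ⋃ (q ∷ qs)
  ⋃-snoc []       q = refl
  ⋃-snoc (p ∷ qs) q = begin
    p ∪ ⋃ (qs List.++ q ∷ [])  ≡⟨ cong (p ∪_) (⋃-snoc qs q) ⟩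
    p ∪ (q ∪ ⋃ qs)             ≡⟨ ∪-assoc p q (⋃ qs) ⟨
    (p ∪ q) ∪ ⋃ qs               ≡⟨ cong (_∪ ⋃ qs) (∪-comm p q) ⟩
    (q ∪ p) ∪ ⋃ qs               ≡⟨ ∪-assoc q p (⋃ qs) ⟩
    q ∪ (p ∪ ⋃ qs)             ∎
    where open ≡-Reasoning

  total-snoc : ∀ qs q → total (qs List.++ q ∷ []) ≡ total (q ∷ qs)
  total-snoc []       q = refl
  total-snoc (p ∷ qs) q = begin
    ∣ p ∣ + total (qs List.++ q ∷ [])  ≡⟨ cong (∣ p ∣ +_) (total-snoc qs q) ⟩
    ∣ p ∣ + (∣ q ∣ + total qs)         ≡⟨ +-assoc ∣ p ∣ ∣ q ∣ (total qs) ⟨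
    ∣ p ∣ + ∣ q ∣ + total qs           ≡⟨ cong (_+ total qs) (+-comm ∣ p ∣ ∣ q ∣) ⟩
    ∣ q ∣ + ∣ p ∣ + total qs           ≡⟨ +-assoc ∣ q ∣ ∣ p ∣ (total qs) ⟩
    ∣ q ∣ + (∣ p ∣ + total qs)         ∎
    where open ≡-Reasoning

  rotate-feasible : ∀ {v t L} → Feasible ((v , t) ∷ L) →
                    Feasible (L List.++ (v , t) ∷ [])
  rotate-feasible {L = L} (_ , _ , (i , ds) ∷ sol) =
    _ , _ , rotate-solution⁺ L i ds sol

  rotate-solved : ∀ {j r v t L u₁ u₂ us} → neighbours v L ≡ u₁ ∷ u₂ ∷ us →
    Solved j r (L List.++ (v , t) ∷ []) → Solved (suc j) r ((v , t) ∷ L)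
  rotate-solved {r = r} {v} {t} {L} several (a , p , opt) = a , rotate several p ,
    record
    { attained =
        let cs , qs , sol , e = Optimum.attained opt
            x , q , ds , ps , sol′ , _ , e′ = rotate-solution⁻ L sol
        in _ , _ , sol′ ,
           trans e (cong (r ∪_) (trans (cong ⋃ e′) (⋃-snoc ps q)))
    ; minimal = λ where
        (_∷_ {q = q} {qs = qs} (i , ds) sol) →
          ≤-trans (Optimum.minimal opt (rotate-solution⁺ L i ds sol))
            (≤-reflexive (cong (∣ r ∣ +_) (total-snoc qs q)))
    }

  -- Termination and the number of iterations

  vertices : List Record → List (Fin n)
  vertices = map proj₁

  absorb-vertices : ∀ r L → vertices (absorb r L) ≡ vertices L
  absorb-vertices r       []            = refl
  absorb-vertices (v , t) ((w , s) ∷ L) with adjacent v w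
  ... | true  = refl
  ... | false = cong (w ∷_) (absorb-vertices (v , t) L)

  -- The list `M List.++ K` is the tail behind `s` once the records in `K` have been rotated to the
  -- end, hence the one that the loop will inspect.
  HasLeaves : Set
  HasLeaves = ∀ r L → Unique (vertices (r ∷ L)) → ∃[ K ] ∃[ s ] ∃[ M ]
    (r ∷ L ≡ K List.++ s ∷ M × List.length (neighbours (proj₁ s) (M List.++ K)) ≤ 1)

  rotate-unique : ∀ r L → Unique (vertices (r ∷ L)) →
                  Unique (vertices (L List.++ r ∷ []))
  rotate-unique (v , t) L (v∉ ∷ u) =
    subst Unique (sym (List.map-++ proj₁ L ((v , t) ∷ []))) (snoc (vertices L) v∉ u)
    where
    snoc : ∀ vs → All (v ≢_) vs → Unique vs → Unique (vs List.++ v ∷ [])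
    snoc []       []        []       = [] ∷ []
    snoc (w ∷ vs) (v≢w ∷ p) (q ∷ u′) = ++⁺ q ((v≢w ∘ sym) ∷ []) ∷ snoc vs p u′

  Solved-mono : ∀ {i j r L} → i ≤ j → Solved i r L → Solved j r L
  Solved-mono i≤j (a , p , opt) = a , Loop-mono i≤j p , opt

  module _ (leaves : HasLeaves) where

    solve : ∀ k r L → List.length L ≡ k → k ≤ n → Unique (vertices L) →
            Feasible L → Solved (k * n) r L
    solve zero r [] refl _ _ _ = r , done , record
      { attained = _ , _ , [] , sym (∪-identityʳ r)
      ; minimal  = λ _ → m≤m+n ∣ r ∣ _
      }
    solve (suc k) r (r₀ ∷ L₀) len k<n u₀ f₀
      with K₀ , s₀ , M₀ , split , few₀ ← leaves r₀ L₀ u₀ =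
      Solved-mono fuel (subst (Solved _ r) (sym split)
        (rounds K₀ s₀ M₀ len₀ few₀
          (subst (Unique ∘ vertices) split u₀) (subst Feasible split f₀)))
      where
      len₀ = trans (cong List.length (sym split)) len
      k≤n = ≤-trans (n≤1+n k) k<n

      -- At most `List.length K₀` rotations and one elimination: `K₀` lacks at least `s₀` among at
      -- most `n` records.
      fuel : List.length K₀ + suc (k * n) ≤ n + k * n
      fuel = begin
        List.length K₀ + suc (k * n)    ≡⟨ +-suc (List.length K₀) (k * n) ⟩
        suc (List.length K₀) + k * n    ≤⟨ +-monoˡ-≤ (k * n) K₀<n ⟩
        n + k * n                       ∎
        where
        open ≤-Reasoning
        K₀<n : suc (List.length K₀) ≤ n
        K₀<n = begin
          suc (List.length K₀)               ≤⟨ s≤s (m≤m+n _ (List.length M₀)) ⟩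
          suc (List.length K₀ + List.length M₀)  ≡⟨ +-suc _ _ ⟨
          List.length K₀ + suc (List.length M₀)  ≡⟨ List.length-++ K₀ ⟨
          List.length (K₀ List.++ s₀ ∷ M₀)   ≡⟨ len₀ ⟩
          suc k                              ≤⟨ k<n ⟩
          n                                  ∎

      eliminate : ∀ v t L → List.length L ≡ k → List.length (neighbours v L) ≤ 1 →
        Unique (vertices ((v , t) ∷ L)) → Feasible ((v , t) ∷ L) →
        Solved (suc (k * n)) r ((v , t) ∷ L)
      eliminate v t L len few (_ ∷ u) f@(_ , _ , (_ ∷ sol)) with neighbours v L in eq
      ... | [] = isolated-solved eq f λ r → solve k r L len k≤n u (_ , _ , sol)
      ... | w ∷ [] = leaf-solved eq
        (solve k r (absorb (v , t) L) (trans (absorb-length (v , t) L) len) k≤n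
          (subst Unique (sym (absorb-vertices (v , t) L)) u) (absorb-feasible eq f))
      ... | _ ∷ _ ∷ _ with s≤s () ← few

      -- Induction on the records ahead of `s`. Any of them that has at most one neighbour is
      -- eliminated on the spot, which leaves fuel over. Otherwise it moves from `K` to the end of
      -- `M`, and `M List.++ K` changes only by associativity, so `few` persists.
      rounds : ∀ K s M → List.length (K List.++ s ∷ M) ≡ suc k →
        List.length (neighbours (proj₁ s) (M List.++ K)) ≤ 1 →
        Unique (vertices (K List.++ s ∷ M)) → Feasible (K List.++ s ∷ M) →
        Solved (List.length K + suc (k * n)) r (K List.++ s ∷ M)
      rounds [] (v , t) M len few u f = eliminate v t M (suc-injective len)
        (subst (λ L → List.length (neighbours v L) ≤ 1) (List.++-identityʳ M) few) u f
      rounds ((v , t) ∷ K) s M len few u f with neighbours v (K List.++ s ∷ M) in eq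
      ... | [] = Solved-mono (m≤n+m _ (suc (List.length K)))
        (eliminate v t _ (suc-injective len)
          (subst (λ N → List.length N ≤ 1) (sym eq) z≤n) u f)
      ... | _ ∷ [] = Solved-mono (m≤n+m _ (suc (List.length K)))
        (eliminate v t _ (suc-injective len)
          (subst (λ N → List.length N ≤ 1) (sym eq) ≤-refl) u f)
      ... | _ ∷ _ ∷ _ = rotate-solved eq (subst (Solved _ r) (sym assoc)
        (rounds K s (M List.++ (v , t) ∷ [])
          (trans (cong List.length (sym assoc)) (trans (rotate-length (v , t) L) len))
          (subst (λ L → List.length (neighbours (proj₁ s) L) ≤ 1)
            (sym (List.++-assoc M ((v , t) ∷ []) K)) few)
          (subst (Unique ∘ vertices) assoc (rotate-unique (v , t) L u))
          (subst Feasible assoc (rotate-feasible f))))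
        where
        L = K List.++ s ∷ M
        assoc : L List.++ (v , t) ∷ [] ≡ K List.++ s ∷ (M List.++ (v , t) ∷ [])
        assoc = List.++-assoc K (s ∷ M) ((v , t) ∷ [])

-- Leaves of forests

below : ∀ {k} (i : Fin (suc k)) → Fin (suc (toℕ i)) → Fin (suc k)
below         i       zero    = zero
below {suc k} (suc i) (suc j) = suc (below i j)

below-injective : ∀ {k} (i : Fin (suc k)) → Injective _≡_ _≡_ (below i)
below-injective {zero}  zero    {zero}  {zero}  eq = refl
below-injective {suc k} zero    {zero}  {zero}  eq = refl
below-injective {suc k} (suc i) {zero}  {zero}  eq = refl
below-injective {suc k} (suc i) {suc _} {suc _} eq =
  cong suc (below-injective i (suc-injectiveᶠ eq))

below-last : ∀ {k} (i : Fin (suc k)) → below i (fromℕ (toℕ i)) ≡ i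
below-last         zero    = refl
below-last {suc k} (suc i) = cong suc (below-last i)

below-step : ∀ {k} (i : Fin (suc k)) (j : Fin (toℕ i)) →
  ∃[ l ] (below i (inject₁ j) ≡ inject₁ l × below i (suc j) ≡ suc l)
below-step {suc k} (suc i) zero    = zero , refl , refl
below-step {suc k} (suc i) (suc j) with l , p , q ← below-step i j =
  suc l , cong suc p , cong suc q

module Walk {n : ℕ} (G : Graph n) where

  open Path
  open Graph G using (irrefl)

  prefix : ∀ {v w k} (p : Path (Edge G) v w k) (i : Fin (suc k)) →
           Path (Edge G) v (vertex p i) (toℕ i)
  prefix p i = record
    { vertex   = vertex p ∘ below i
    ; distinct = below-injective i ∘ distinct p
    ; starts   = starts p
    ; ends     = cong (vertex p) (below-last i)
    ; step     = λ j → let l , eq , eq′ = below-step i j in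
        subst₂ (Edge G) (cong (vertex p) (sym eq)) (cong (vertex p) (sym eq′))
          (step p l)
    }

  trivial : ∀ v → Path (Edge G) v v 0
  trivial v = record
    { vertex = λ _ → v ; distinct = λ { {0F} {0F} _ → refl }
    ; starts = refl ; ends = refl ; step = λ () }

  extend : ∀ {v w k x} (p : Path (Edge G) v w k) → Edge G x v →
           (∀ i → vertex p i ≢ x) → Path (Edge G) x w (suc k)
  extend {x = x} p e new = record
    { vertex = vs ; distinct = inj ; starts = refl ; ends = ends p ; step = st }
    where
    vs : Fin _ → Fin n
    vs zero    = x
    vs (suc i) = vertex p i
    inj : Injective _≡_ _≡_ vs
    inj {zero}  {zero}  eq = refl
    inj {zero}  {suc j} eq = contradiction (sym eq) (new j)
    inj {suc i} {zero}  eq = contradiction eq (new i)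
    inj {suc i} {suc j} eq = cong suc (distinct p eq)
    st : ∀ i → Edge G (vs (inject₁ i)) (vs (suc i))
    st zero    = subst (Edge G x) (sym (starts p)) e
    st (suc i) = step p i

  -- The second vertex of a path, or its only one.
  second : ∀ {v w k} → Path (Edge G) v w k → Fin n
  second {k = zero}  p = vertex p 0F
  second {k = suc k} p = vertex p 1F

  -- If `x` were the first vertex of `p`, the edge would be a loop; being the second is excluded by
  -- hypothesis; from the third on, the prefix up to `x` and the edge form a cycle.
  close : ∀ {v w k x} (p : Path (Edge G) v w k) → Edge G x v → x ≢ second p →
          ∀ i → vertex p i ≡ x → Cycle G
  close {v = v} p e x≢ zero eq =
    contradiction (subst (λ y → Edge G y v) (trans (sym eq) (starts p)) e) (irrefl refl)
  close {k = suc k} p e x≢ (suc zero)    refl = contradiction refl x≢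
  close {k = suc k} p e x≢ (suc (suc i)) refl = _ , _ , toℕ i , prefix p (suc (suc i)) , e

  -- If every vertex of vs has two neighbours in vs, paths can be extended
  -- without turning back until they close to a cycle.
  module _ (acyclic : ¬ Cycle G) (vs : List (Fin n)) {v₀ : Fin n} (v₀∈ : v₀ ∈ˡ vs)
           (next : ∀ {v} → v ∈ˡ vs → ∀ u → ∃[ x ] (x ∈ˡ vs × Edge G x v × x ≢ u))
           where

    long-path : ∀ k → ∃[ v ] ∃[ w ] (v ∈ˡ vs × Path (Edge G) v w k)
    long-path zero = v₀ , v₀ , v₀∈ , trivial v₀
    long-path (suc k) with v , w , v∈ , p ← long-path k
      with x , x∈ , e , x≢ ← next v∈ (second p) =
      x , w , x∈ , extend p e λ i eq → acyclic (close p e x≢ i eq)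

    impossible : ∀ {A : Set} → A
    -- A path with `n` arcs has `n + 1` distinct vertices, one too many.
    impossible with _ , _ , _ , p ← long-path n =
      contradiction (injective⇒≤ (distinct p)) 1+n≰n

module Leaves {n : ℕ} (D : Digraph n) (G : Graph n) (acyclic : ¬ Cycle G)
              (orientation : IsOrientationOf D G) where

  open Algorithm D
  open Elimination D
  open IsOrientationOf orientation
  open Graph G using (irrefl) renaming (sym to edge-sym)

  adjacent-edge : ∀ v w → T (adjacent v w) → Edge G v w
  adjacent-edge v w
    rewrite meets-⁅⁆ (row v) w | meets-⁅⁆ (row w) v
          | lookup∘tabulate (D v) w | lookup∘tabulate (D w) v
    with D v w in eq | D w v in eq′
  ... | true  | _    = λ _ → arc⇒edge (subst T (sym eq) tt)
  ... | false | true = λ _ → edge-sym (arc⇒edge (subst T (sym eq′) tt))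

  adjacent-irrefl : ∀ v → adjacent v v ≡ false
  adjacent-irrefl v with adjacent v v | adjacent-edge v v
  ... | false | _ = refl
  ... | true  | e = contradiction (e tt) (irrefl refl)

  degree : Fin n → List (Fin n) → ℕ
  degree v vs = List.length (filterᵇ (adjacent v) vs)

  neighbours-length : ∀ v L → List.length (neighbours v L) ≡ degree v (vertices L)
  neighbours-length v []            = refl
  neighbours-length v ((w , s) ∷ L) with adjacent v w
  ... | true  = cong suc (neighbours-length v L)
  ... | false = neighbours-length v L

  -- Otherwise every vertex of the list has two neighbours in it, distinct because the list has no
  -- repetitions, and one of them avoids any given `u`. So a path could always go on without turning
  -- back.
  low-degree : ∀ v₀ vs → Unique (v₀ ∷ vs) →
    Any (λ v → degree v (v₀ ∷ vs) ≤ 1) (v₀ ∷ vs)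
  low-degree v₀ vs u with Any.any? (λ v → degree v (v₀ ∷ vs) ≤? 1) (v₀ ∷ vs)
  ... | yes found = found
  ... | no  none  = Walk.impossible G acyclic (v₀ ∷ vs) (here refl) next
    where
    next : ∀ {v} → v ∈ˡ v₀ ∷ vs → ∀ u → ∃[ x ] (x ∈ˡ v₀ ∷ vs × Edge G x v × x ≢ u)
    next {v} v∈ u′ with filterᵇ (adjacent v) (v₀ ∷ vs) in eq
        | Unique.filter⁺ (T? ∘ adjacent v) u
        | (λ x → ∈-filter⁻ (T? ∘ adjacent v) {x} {v₀ ∷ vs})
        | All.lookup (All.¬Any⇒All¬ (v₀ ∷ vs) none) v∈
    ... | [] | _ | _ | many = contradiction z≤n many
    ... | a ∷ [] | _ | _ | many = contradiction ≤-refl many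
    ... | a ∷ b ∷ _ | (a≢b ∷ _) ∷ _ | mem | _ with a ≟ᶠ u′
    ...   | no a≢u with a∈ , adj ← mem a (here refl) =
      a , a∈ , edge-sym (adjacent-edge v a adj) , a≢u
    ...   | yes refl with b∈ , adj ← mem b (there (here refl)) =
      b , b∈ , edge-sym (adjacent-edge v b adj) , a≢b ∘ sym

  degree-split : ∀ v K M → degree v (M List.++ K) ≡ degree v (K List.++ v ∷ M)
  degree-split v K M = begin
    degree v (M List.++ K)         ≡⟨ cong List.length (List.filter-++ P? M K) ⟩
    _                              ≡⟨ List.length-++ (filter P? M) ⟩
    degree v M + degree v K        ≡⟨ +-comm (degree v M) _ ⟩
    degree v K + degree v M        ≡⟨ cong (degree v K +_) (cong List.length reject) ⟨
    degree v K + degree v (v ∷ M)  ≡⟨ List.length-++ (filter P? K) ⟨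
    _                              ≡⟨ cong List.length (List.filter-++ P? K (v ∷ M)) ⟨
    degree v (K List.++ v ∷ M)     ∎
    where
    open ≡-Reasoning
    P? = T? ∘ adjacent v
    reject : filter P? (v ∷ M) ≡ filter P? M
    reject = List.filter-reject P? (subst (¬_ ∘ T) (sym (adjacent-irrefl v)) λ ())

  leaves : HasLeaves
  leaves r L u with v , v∈ , low ← find (low-degree (proj₁ r) (vertices L) u)
    with (.v , t) , s∈ , refl ← ∈-map⁻ proj₁ {xs = r ∷ L} v∈
    with K , M , split ← ∈-∃++ s∈ = K , (v , t) , M , split , (begin
      List.length (neighbours v (M List.++ K))        ≡⟨ neighbours-length v (M List.++ K) ⟩
      degree v (vertices (M List.++ K))               ≡⟨ cong (degree v) (List.map-++ proj₁ M K) ⟩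
      degree v (vertices M List.++ vertices K)        ≡⟨ degree-split v (vertices K) (vertices M) ⟩
      degree v (vertices K List.++ v ∷ vertices M)    ≡⟨ cong (degree v) (List.map-++ proj₁ K _) ⟨
      degree v (vertices (K List.++ (v , t) ∷ M))     ≡⟨ cong (degree v ∘ vertices) split ⟨
      degree v (vertices (r ∷ L))                     ≤⟨ low ⟩
      1                                               ∎)
    where open ≤-Reasoning

-- Quasi-kernels as solutions

module QuasiKernels {n : ℕ} (D : Digraph n) (loopless : ∀ v → ¬ Arc D v v) where

  open Algorithm D
  open Elimination D

  Stable : Subset n → Set
  Stable Q = ∀ {v w} → v ∈ Q → w ∈ Q → ¬ Arc D v w

  -- Distance at most two, freed from minimality and from the distinctness of the vertices of a
  -- path.
  data Near (Q : Subset n) (v : Fin n) : Set where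
    zero-steps : v ∈ Q → Near Q v
    one-step   : ∀ {w} → Arc D v w → w ∈ Q → Near Q v
    two-steps  : ∀ {u w} → Arc D v u → Arc D u w → w ∈ Q → Near Q v

  open Path

  edge-path : ∀ {v w} → Arc D v w → Path (Arc D) v w 1
  edge-path {v} {w} a = record
    { vertex = lookup (v ∷ w ∷ []) ; distinct = inj ; starts = refl ; ends = refl
    ; step = λ { 0F → a } }
    where
    inj : Injective _≡_ _≡_ (lookup (v ∷ w ∷ []))
    inj {0F} {0F} _    = refl
    inj {0F} {1F} refl = contradiction a (loopless v)
    inj {1F} {0F} refl = contradiction a (loopless v)
    inj {1F} {1F} _    = refl

  two-path : ∀ {v u w} → v ≢ w → Arc D v u → Arc D u w → Path (Arc D) v w 2
  two-path {v} {u} {w} v≢w a b = record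
    { vertex = lookup (v ∷ u ∷ w ∷ []) ; distinct = inj ; starts = refl ; ends = refl
    ; step = λ { 0F → a ; 1F → b } }
    where
    inj : Injective _≡_ _≡_ (lookup (v ∷ u ∷ w ∷ []))
    inj {0F} {0F} _    = refl
    inj {0F} {1F} refl = contradiction a (loopless v)
    inj {0F} {2F} eq   = contradiction eq v≢w
    inj {1F} {0F} refl = contradiction a (loopless v)
    inj {1F} {1F} _    = refl
    inj {1F} {2F} refl = contradiction b (loopless u)
    inj {2F} {0F} eq   = contradiction (sym eq) v≢w
    inj {2F} {1F} refl = contradiction b (loopless u)
    inj {2F} {2F} _    = refl

  path-0 : ∀ {v w} → Path (Arc D) v w 0 → v ≡ w
  path-0 p = trans (sym (starts p)) (ends p)

  path-1 : ∀ {v w} → Path (Arc D) v w 1 → Arc D v w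
  path-1 p = subst₂ (Arc D) (starts p) (ends p) (step p 0F)

  path-2 : ∀ {v w} → Path (Arc D) v w 2 → ∃[ u ] (Arc D v u × Arc D u w)
  path-2 p = _ , subst (λ v → Arc D v _) (starts p) (step p 0F) ,
                 subst (Arc D _) (ends p) (step p 1F)

  quasiKernel⁺ : ∀ {Q} → Stable Q → (∀ v → Near Q v) → IsQuasiKernel D Q
  quasiKernel⁺ {Q} stable near = record
    { independent = λ where
        v∈ w∈ _ (inj₁ a) → stable v∈ w∈ a
        v∈ w∈ _ (inj₂ a) → stable w∈ v∈ a
    ; absorbing = λ v v∉ → absorbed v∉ (near v)
    }
    where
    absorbed : ∀ {v} → v ∉ Q → Near Q v →
               ∃[ w ] (w ∈ Q × ∃[ k ] (IsDistance D v w k × k ≤ 2))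
    absorbed v∉ (zero-steps v∈) = contradiction v∈ v∉
    absorbed v∉ (one-step {w} a w∈) = w , w∈ , 1 , (edge-path a , λ where
      zero    p → contradiction (subst (_∈ Q) (sym (path-0 p)) w∈) v∉
      (suc j) p → s≤s z≤n) , s≤s z≤n
    -- A direct arc from `v` to `w` makes the distance one instead of two.
    absorbed {v} v∉ (two-steps {u} {w} a b w∈) with T? (D v w)
    ... | yes c = absorbed v∉ (one-step c w∈)
    ... | no ¬c = w , w∈ , 2 , (two-path v≢w a b , λ where
      zero          p → contradiction (path-0 p) v≢w
      (suc zero)    p → contradiction (path-1 p) ¬c
      (suc (suc j)) p → s≤s (s≤s z≤n)) , ≤-refl
      where
      v≢w : v ≢ w
      v≢w refl = v∉ w∈

  quasiKernel⁻ : ∀ {Q} → IsQuasiKernel D Q → Stable Q × (∀ v → Near Q v)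
  quasiKernel⁻ {Q} qk = stable , near
    where
    open IsQuasiKernel qk
    stable : Stable Q
    stable {v} {w} v∈ w∈ a with v ≟ᶠ w
    ... | yes refl = loopless v a
    ... | no v≢w   = independent v∈ w∈ v≢w (inj₁ a)
    near : ∀ v → Near Q v
    near v with v ∈? Q
    ... | yes v∈ = zero-steps v∈
    ... | no v∉ with absorbing v v∉
    ...   | w , w∈ , zero , (p , _) , _ =
      zero-steps (subst (_∈ Q) (sym (path-0 p)) w∈)
    ...   | w , w∈ , suc zero , (p , _) , _ = one-step (path-1 p) w∈
    ...   | w , w∈ , suc (suc zero) , (p , _) , _ with u , a , b ← path-2 p =
      two-steps a b w∈
    ...   | w , w∈ , suc (suc (suc _)) , _ , s≤s (s≤s ())

  -- Chvátal and Lovász: take v, and a quasi-kernel of what is left when v and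
  -- its in-neighbours are deleted; v is added unless it has an arc into it.
  chvátal-lovász : ∀ k (A : List (Fin n)) → List.length A ≤ k →
    ∃[ Q ] ((∀ {v} → v ∈ Q → v ∈ˡ A) × Stable Q × (∀ {v} → v ∈ˡ A → Near Q v))
  chvátal-lovász k [] _ =
    ⊥ , (λ v∈ → ⊥-elim (∉⊥ v∈)) , (λ v∈ → ⊥-elim (∉⊥ v∈)) , λ ()
  chvátal-lovász (suc k) (v ∷ A) (s≤s A≤)
    with Q , Q⊆ , stable , near ← chvátal-lovász k (filter (λ x → ¬? (T? (D x v))) A)
           (≤-trans (List.length-filter (λ x → ¬? (T? (D x v))) A) A≤)
    with any? (λ w → (w ∈? Q) ×-dec T? (D v w))
  ... | yes (w , w∈ , a) = Q , there ∘ Q⊆A , stable , near′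
    where
    Q⊆A : ∀ {x} → x ∈ Q → x ∈ˡ A
    Q⊆A x∈ = proj₁ (∈-filter⁻ (λ x → ¬? (T? (D x v))) (Q⊆ x∈))
    near′ : ∀ {x} → x ∈ˡ v ∷ A → Near Q x
    near′ (here refl) = one-step a w∈
    near′ {x} (there x∈) with T? (D x v)
    ... | yes b = two-steps b a w∈
    ... | no ¬b = near (∈-filter⁺ (λ x → ¬? (T? (D x v))) x∈ ¬b)
  ... | no none = Q ∪ ⁅ v ⁆ , ⊆A , stable′ , near′
    where
    Q⊆A : ∀ {x} → x ∈ Q → x ∈ˡ A × ¬ Arc D x v
    Q⊆A x∈ = ∈-filter⁻ (λ x → ¬? (T? (D x v))) (Q⊆ x∈)

    ⊆A : ∀ {x} → x ∈ Q ∪ ⁅ v ⁆ → x ∈ˡ v ∷ A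
    ⊆A x∈ with x∈p∪q⁻ Q ⁅ v ⁆ x∈
    ... | inj₁ x∈Q = there (proj₁ (Q⊆A x∈Q))
    ... | inj₂ x∈v = here (x∈⁅y⁆⇒x≡y v x∈v)

    stable′ : Stable (Q ∪ ⁅ v ⁆)
    stable′ x∈ y∈ a with x∈p∪q⁻ Q ⁅ v ⁆ x∈ | x∈p∪q⁻ Q ⁅ v ⁆ y∈
    ... | inj₁ x∈Q | inj₁ y∈Q = stable x∈Q y∈Q a
    ... | inj₁ x∈Q | inj₂ y∈v with refl ← x∈⁅y⁆⇒x≡y v y∈v = proj₂ (Q⊆A x∈Q) a
    ... | inj₂ x∈v | inj₁ y∈Q with refl ← x∈⁅y⁆⇒x≡y v x∈v = none (_ , y∈Q , a)
    ... | inj₂ x∈v | inj₂ y∈v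
      with refl ← x∈⁅y⁆⇒x≡y v x∈v | refl ← x∈⁅y⁆⇒x≡y v y∈v = loopless v a

    v∈ : v ∈ Q ∪ ⁅ v ⁆
    v∈ = x∈p∪q⁺ (inj₂ (x∈⁅x⁆ v))

    weaken : ∀ {x} → Near Q x → Near (Q ∪ ⁅ v ⁆) x
    weaken (zero-steps x∈)    = zero-steps (x∈p∪q⁺ (inj₁ x∈))
    weaken (one-step a w∈)    = one-step a (x∈p∪q⁺ (inj₁ w∈))
    weaken (two-steps a b w∈) = two-steps a b (x∈p∪q⁺ (inj₁ w∈))

    near′ : ∀ {x} → x ∈ˡ v ∷ A → Near (Q ∪ ⁅ v ⁆) x
    near′ (here refl) = zero-steps v∈
    near′ {x} (there x∈) with T? (D x v)
    ... | yes b = one-step b v∈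
    ... | no ¬b = weaken (near (∈-filter⁺ (λ x → ¬? (T? (D x v))) x∈ ¬b))

  quasiKernel-exists : ∃[ Q ] IsQuasiKernel D Q
  quasiKernel-exists with Q , _ , stable , near ← chvátal-lovász _ (List.allFin n) ≤-refl =
    Q , quasiKernel⁺ stable (λ v → near (∈-allFin v))

  -- Options in the initial tables

  data InitialOption (v : Fin n) : Label v → Subset n → Set where
    inside : InitialOption v inside ⁅ v ⁆
    one    : ∀ w .a → InitialOption v (one w a) ⊥
    two    : ∀ w .a → InitialOption v (two w a) ⊥

  arcOption : ∀ v w b eq {x q} → (x , q) ∈ˡ arcOptions v w b eq → InitialOption v x q
  arcOption v w true eq (here refl)         = one w _
  arcOption v w true eq (there (here refl)) = two w _

  pointer-option : ∀ v {m} (f : Fin m → Fin n) {x q} → (x , q) ∈ˡ pointers v f →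
                   InitialOption v x q
  pointer-option v {suc m} f i
    with ∈-++⁻ (arcOptions v (f zero) (D v (f zero)) refl) i
  ... | inj₁ j = arcOption v (f zero) _ refl j
  ... | inj₂ j = pointer-option v (f ∘ suc) j

  initial-option : ∀ v {x q} → (x , q) ∈ˡ initialTable v → InitialOption v x q
  initial-option v (here refl) = inside
  initial-option v (there i)   = pointer-option v (λ w → w) i

  -- The arc in a label is irrelevant, so the label built from `eq` and the one built from `a` are
  -- equal by `refl`.
  arcOptions-∋ : ∀ v w b eq (a : Arc D v w) →
    (one w a , ⊥) ∈ˡ arcOptions v w b eq × (two w a , ⊥) ∈ˡ arcOptions v w b eq
  arcOptions-∋ v w true  eq a = here refl , there (here refl)
  arcOptions-∋ v w false eq a = contradiction (subst T eq a) λ ()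

  pointers-∋ : ∀ v {m} (f : Fin m → Fin n) i (a : Arc D v (f i)) →
    (one (f i) a , ⊥) ∈ˡ pointers v f × (two (f i) a , ⊥) ∈ˡ pointers v f
  pointers-∋ v f zero a with i , j ← arcOptions-∋ v (f zero) (D v (f zero)) refl a =
    ∈-++⁺ˡ i , ∈-++⁺ˡ j
  pointers-∋ v f (suc i) a with j , k ← pointers-∋ v (f ∘ suc) i a =
    ∈-++⁺ʳ options j , ∈-++⁺ʳ options k
    where options = arcOptions v (f zero) (D v (f zero)) refl

  initialTable-∋ : ∀ v {x q} → InitialOption v x q → (x , q) ∈ˡ initialTable v
  initialTable-∋ v inside    = here refl
  initialTable-∋ v (one w a) =
    there (proj₁ (pointers-∋ v (λ w → w) w (recompute (T? (D v w)) a)))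
  initialTable-∋ v (two w a) =
    there (proj₂ (pointers-∋ v (λ w → w) w (recompute (T? (D v w)) a)))

  pointers-length : ∀ v {m} (f : Fin m → Fin n) → List.length (pointers v f) ≤ m + m
  pointers-length v {zero}  f = z≤n
  pointers-length v {suc m} f = begin
    List.length (options List.++ pointers v (f ∘ suc))
      ≡⟨ List.length-++ options ⟩
    List.length options + List.length (pointers v (f ∘ suc))
      ≤⟨ +-mono-≤ (options-length (D v (f zero)) refl) (pointers-length v (f ∘ suc)) ⟩
    2 + (m + m)
      ≡⟨ cong suc (+-suc m m) ⟨
    suc m + suc m  ∎
    where
    open ≤-Reasoning
    options = arcOptions v (f zero) (D v (f zero)) refl
    options-length : ∀ b eq → List.length (arcOptions v (f zero) b eq) ≤ 2
    options-length true  eq = ≤-refl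
    options-length false eq = z≤n

  initial-small : All (Small (tableBound n)) initial
  initial-small = All.tabulate⁺ (λ v → s≤s (pointers-length v (λ w → w)))

  -- The labels that a quasi-kernel may give to `v`. The kind `two` is reserved for vertices without
  -- an arc into `Q`: the target `u` of such a label has an arc into `Q`, hence cannot carry `two`
  -- itself, as compatibility requires.
  data Justified (Q : Subset n) (v : Fin n) : Label v → Set where
    inside : v ∈ Q → Justified Q v inside
    one    : ∀ {w} .{a} → v ∉ Q → w ∈ Q → Justified Q v (one w a)
    two    : ∀ {u w} .{a} → v ∉ Q → (∀ {z} → z ∈ Q → ¬ Arc D v z) →
             Arc D u w → w ∈ Q → u ∉ Q → Justified Q v (two u a)

  justify : ∀ {Q} v → Near Q v → ∃[ x ] Justified Q v x
  justify {Q} v near with v ∈? Q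
  ... | yes v∈ = inside , inside v∈
  ... | no v∉ with any? (λ w → (w ∈? Q) ×-dec T? (D v w))
  ...   | yes (w , w∈ , a) = one w a , one v∉ w∈
  ...   | no none with near
  ...     | zero-steps v∈          = contradiction v∈ v∉
  ...     | one-step a w∈          = contradiction (_ , w∈ , a) none
  ...     | two-steps {u} a b w∈ =
    two u a , two v∉ (λ z∈ c → none (_ , z∈ , c)) b w∈ λ u∈ → none (u , u∈ , a)

  justified-excludes : ∀ {Q v w x y} → Stable Q → Justified Q v x → Justified Q w y →
                       excludes x y ≡ false
  justified-excludes {v = v} {w} stable (inside v∈) (inside w∈) with D v w in eq
  ... | false = refl
  ... | true  = contradiction (subst T (sym eq) tt) (stable v∈ w∈)
  justified-excludes stable (inside _) (one _ _)       = refl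
  justified-excludes stable (inside _) (two _ _ _ _ _) = refl
  justified-excludes stable (one _ _)  (inside _)      = refl
  justified-excludes {w = w} stable (one {u} _ u∈) (one w∉ _)
    with lookup ⁅ u ⁆ w in eq
  ... | false = refl
  ... | true with refl ← lookup-⁅⁆ {u = u} {w} eq = contradiction u∈ w∉
  justified-excludes {w = w} stable (one {u} _ u∈) (two w∉ _ _ _ _)
    with lookup ⁅ u ⁆ w in eq
  ... | false = refl
  ... | true with refl ← lookup-⁅⁆ {u = u} {w} eq = contradiction u∈ w∉
  justified-excludes {w = w} stable (two {u} _ _ _ _ u∉) (inside w∈)
    with lookup ⁅ u ⁆ w in eq
  ... | false = refl
  ... | true with refl ← lookup-⁅⁆ {u = u} {w} eq = contradiction w∈ u∉
  justified-excludes stable (two _ _ _ _ _) (one _ _) = refl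
  justified-excludes {w = w} stable (two {u} _ _ a z∈ _) (two _ none _ _ _)
    with lookup ⁅ u ⁆ w in eq
  ... | false = refl
  ... | true with refl ← lookup-⁅⁆ {u = u} {w} eq = contradiction a (none z∈)

  mark : Subset n → Fin n → Subset n
  mark Q v = if lookup Q v then ⁅ v ⁆ else ⊥

  justified-option : ∀ {Q v x} → Justified Q v x → InitialOption v x (mark Q v)
  justified-option (inside v∈) rewrite []=⇒lookup v∈ = inside
  justified-option {Q} {v} (one v∉ _) with lookup Q v in eq
  ... | false = one _ _
  ... | true  = contradiction (lookup⇒[]= v Q eq) v∉
  justified-option {Q} {v} (two v∉ _ _ _ _) with lookup Q v in eq
  ... | false = two _ _
  ... | true  = contradiction (lookup⇒[]= v Q eq) v∉

  total-indicator : ∀ {m} (p : Subset m) (g : Fin m → Subset n) →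
    (∀ i → ∣ g i ∣ ≡ (if lookup p i then 1 else 0)) → total (List.tabulate g) ≡ ∣ p ∣
  total-indicator []          g eq = refl
  total-indicator (true ∷ p)  g eq =
    cong₂ _+_ (eq zero) (total-indicator p (g ∘ suc) (eq ∘ suc))
  total-indicator (false ∷ p) g eq =
    cong₂ _+_ (eq zero) (total-indicator p (g ∘ suc) (eq ∘ suc))

  mark-size : ∀ Q v → ∣ mark Q v ∣ ≡ (if lookup Q v then 1 else 0)
  mark-size Q v with lookup Q v
  ... | true  = ∣⁅x⁆∣≡1 v
  ... | false = ∣⊥∣≡0 n

  -- Each vertex of `Q` contributes its own singleton and every other vertex nothing, so the total
  -- is an exact count.
  quasiKernel-solution : ∀ {Q} → IsQuasiKernel D Q →
    ∃[ cs ] ∃[ qs ] (Solution initial cs qs × total qs ≡ ∣ Q ∣)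
  quasiKernel-solution {Q} qk =
    _ , _ , solution (λ v → v) , total-indicator Q (mark Q) (mark-size Q)
    where
    stable : Stable Q
    stable = proj₁ (quasiKernel⁻ qk)

    label : ∀ v → ∃[ x ] Justified Q v x
    label v = justify v (proj₂ (quasiKernel⁻ qk) v)

    choice : Fin n → Choice
    choice v = v , proj₁ (label v)

    compatible-choices : ∀ v w → Compatible (choice v) (choice w)
    compatible-choices v w = compatible⁺ {x = proj₁ (label v)} {proj₁ (label w)}
      (justified-excludes stable (proj₂ (label v)) (proj₂ (label w)))
      (justified-excludes stable (proj₂ (label w)) (proj₂ (label v)))

    solution : ∀ {m} (f : Fin m → Fin n) → Solution (initialRecords f)
      (List.tabulate (choice ∘ f)) (List.tabulate (mark Q ∘ f))
    solution {zero}  f = []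
    solution {suc m} f =
      (initialTable-∋ (f zero) (justified-option (proj₂ (label (f zero)))) ,
       All.tabulate⁺ (λ i → compatible-choices (f zero) (f (suc i)))) ∷
      solution (f ∘ suc)

  -- From solutions back to quasi-kernels

  pick : ∀ {L cs qs v t} → Solution L cs qs → (v , t) ∈ˡ L →
    ∃[ x ] ∃[ q ] ((x , q) ∈ˡ t × (v , x) ∈ˡ cs × q ∈ˡ qs)
  pick ((i , _) ∷ sol) (here refl) = _ , _ , i , here refl , here refl
  pick (_ ∷ sol) (there r∈) with x , q , i , c∈ , q∈ ← pick sol r∈ =
    x , q , i , there c∈ , there q∈

  source : ∀ {L cs qs q} → Solution L cs qs → q ∈ˡ qs →
    ∃[ v ] ∃[ t ] ∃[ x ] ((v , t) ∈ˡ L × (x , q) ∈ˡ t × (v , x) ∈ˡ cs)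
  source ((i , _) ∷ sol) (here refl) = _ , _ , _ , here refl , i , here refl
  source (_ ∷ sol) (there q∈) with v , t , x , r∈ , i , c∈ ← source sol q∈ =
    v , t , x , there r∈ , i , there c∈

  pairwise : ∀ {L cs qs c d} → Solution L cs qs → c ∈ˡ cs → d ∈ˡ cs →
             proj₁ c ≢ proj₁ d → Compatible c d
  pairwise (_ ∷ sol)        (here refl) (here refl) c≢d = contradiction refl c≢d
  pairwise ((_ , cs) ∷ sol) (here refl) (there j)   c≢d = All.lookup cs j
  pairwise ((_ , cs) ∷ sol) (there i)   (here refl) c≢d =
    compatible-sym (All.lookup cs i)
  pairwise (_ ∷ sol)        (there i)   (there j)   c≢d = pairwise sol i j c≢d

  ⋃⁺ : ∀ {v q qs} → q ∈ˡ qs → v ∈ q → v ∈ ⋃ qs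
  ⋃⁺ (here refl) v∈ = x∈p∪q⁺ (inj₁ v∈)
  ⋃⁺ (there q∈)  v∈ = x∈p∪q⁺ (inj₂ (⋃⁺ q∈ v∈))

  ⋃⁻ : ∀ {v} qs → v ∈ ⋃ qs → ∃[ q ] (q ∈ˡ qs × v ∈ q)
  ⋃⁻ []       v∈ = ⊥-elim (∉⊥ v∈)
  ⋃⁻ (q ∷ qs) v∈ with x∈p∪q⁻ q (⋃ qs) v∈
  ... | inj₁ v∈q = q , here refl , v∈q
  ... | inj₂ v∈⋃ with p , p∈ , v∈p ← ⋃⁻ qs v∈⋃ = p , there p∈ , v∈p

  solution-quasiKernel : ∀ {cs qs} → Solution initial cs qs → IsQuasiKernel D (⋃ qs)
  solution-quasiKernel {cs} {qs} sol = quasiKernel⁺ stable near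
    where
    picked : ∀ v → ∃[ x ] ∃[ q ] (InitialOption v x q × (v , x) ∈ˡ cs × q ∈ˡ qs)
    picked v with x , q , i , c∈ , q∈ ← pick sol (∈-tabulate⁺ {f = λ v → v , initialTable v} v) =
      x , q , initial-option v i , c∈ , q∈

    -- Only `inside` contributes an element, namely the vertex that it labels, so an element of the
    -- union can be traced to its own record.
    chosen : ∀ {v} → v ∈ ⋃ qs → (v , inside) ∈ˡ cs
    chosen v∈ with q , q∈ , v∈q ← ⋃⁻ qs v∈
      with u , t , x , r∈ , i , c∈ ← source sol q∈
      with .u , refl ← ∈-tabulate⁻ {f = λ v → v , initialTable v} r∈
      with initial-option u i
    ... | one w a = ⊥-elim (∉⊥ v∈q)
    ... | two w a = ⊥-elim (∉⊥ v∈q)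
    ... | inside with refl ← x∈⁅y⁆⇒x≡y u v∈q = c∈

    stable : Stable (⋃ qs)
    stable {v} {w} v∈ w∈ a with v ≟ᶠ w
    ... | yes refl = loopless v a
    ... | no v≢w = subst T
      (proj₁ (compatible⁻ (pairwise sol (chosen v∈) (chosen w∈) v≢w))) a

    self : ∀ (v : Fin n) → lookup ⁅ v ⁆ v ≢ false
    self v eq with () ← trans (sym ([]=⇒lookup (x∈⁅x⁆ v))) eq

    distinct-ends : ∀ {v w} → Arc D v w → v ≢ w
    distinct-ends a refl = loopless _ a

    one-inside : ∀ {v w} .{a : Arc D v w} → (v , one w a) ∈ˡ cs → Arc D v w →
                 w ∈ ⋃ qs
    one-inside {v} {w} c∈ a with y , q , opt , d∈ , q∈ ← picked w
      with compatible⁻ (pairwise sol c∈ d∈ (distinct-ends a)) | opt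
    ... | _      | inside  = ⋃⁺ q∈ (x∈⁅x⁆ w)
    ... | eq , _ | one _ _ = contradiction eq (self w)
    ... | eq , _ | two _ _ = contradiction eq (self w)

    near : ∀ v → Near (⋃ qs) v
    near v with picked v
    ... | _ , _ , inside , _ , q∈ = zero-steps (⋃⁺ q∈ (x∈⁅x⁆ v))
    ... | _ , _ , one w a , c∈ , _ with a′ ← recompute (T? (D v w)) a =
      one-step a′ (one-inside c∈ a′)
    ... | _ , _ , two u a , c∈ , _ with a′ ← recompute (T? (D v u)) a
      with y , q , opt , d∈ , q∈ ← picked u
      with compatible⁻ (pairwise sol c∈ d∈ (distinct-ends a′)) | opt
    ...   | eq , _ | inside  = contradiction eq (self u)
    ...   | _      | one w b with b′ ← recompute (T? (D u w)) b =
      two-steps a′ b′ (one-inside d∈ b′)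
    ...   | eq , _ | two _ _ = contradiction eq (self u)

-- Orientations of trees

module OrientedTree {n : ℕ} (D : Digraph n) (G : Graph n) (tree : IsTree G)
                    (orientation : IsOrientationOf D G) where

  open Algorithm D
  open Elimination D
  open Leaves D G (IsTree.acyclic tree) orientation

  loopless : ∀ v → ¬ Arc D v v
  loopless v a = Graph.irrefl G refl (IsOrientationOf.arc⇒edge orientation a)

  open QuasiKernels D loopless

  initial-unique : Unique (vertices initial)
  initial-unique = subst Unique (sym (List.map-tabulate (λ v → v , initialTable v) proj₁))
    (Unique.tabulate⁺ (λ eq → eq))

  solved : Solved (roundBound n) ⊥ initial
  -- Any quasi-kernel at all makes the initial tables feasible.
  solved = let Q , qk = quasiKernel-exists
               cs , qs , sol , _ = quasiKernel-solution qk in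
    solve leaves n ⊥ initial (List.length-tabulate (λ v → v , initialTable v)) ≤-refl
      initial-unique (cs , qs , sol)

  optimum-minimal : ∀ {a} → Optimum ⊥ initial a → IsMinQuasiKernel D a
  optimum-minimal {a} opt = quasiKernel , smallest
    where
    quasiKernel : IsQuasiKernel D a
    quasiKernel with _ , qs , sol , refl ← Optimum.attained opt =
      subst (IsQuasiKernel D) (sym (∪-identityˡ (⋃ qs))) (solution-quasiKernel sol)

    smallest : ∀ Q → IsQuasiKernel D Q → ∣ a ∣ ≤ ∣ Q ∣
    smallest Q qk with _ , qs , sol , eq ← quasiKernel-solution qk = begin
      ∣ a ∣                  ≤⟨ Optimum.minimal opt sol ⟩
      ∣ ⊥ {n} ∣ + total qs   ≡⟨ cong₂ _+_ (∣⊥∣≡0 n) eq ⟩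
      ∣ Q ∣                  ∎
      where open ≤-Reasoning

-- Turns a bound that is polynomial in `suc n` into one in the size of the input.
size-encodeVec : ∀ {A : Set} (enc : A → Value) {n} (xs : Vec A n) →
                 suc n ≤ size (encodeVec enc xs)
size-encodeVec enc []       = ≤-refl
size-encodeVec enc (x ∷ xs) = s≤s
  (≤-trans (size-encodeVec enc xs) (m≤n+m _ (size (enc x))))

SolvedWithin : ∀ {n} → Digraph n → ℕ → Set
SolvedWithin D T = ∃[ a ] (IsMinQuasiKernel D a ×
  ∃[ t ] (Runs minQuasiKernel (encodeDigraph D) (bits a) t × t ≤ T))

polynomial-solvable : ∀ {f} → Polynomial f →
  (∀ {n} (D : Digraph n) → IsOrientedTree D → SolvedWithin D (f n)) →
  PolynomialTimeSolvableOn MinQuasiKernel OrientationsOfTrees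
polynomial-solvable {f} (c , d , f≤) solved = minQuasiKernel , c , d ,
  λ (n , D) tree → let a , minimal , t , runs , t≤ = solved D tree in
    a , minimal , t , runs , ≤-trans t≤ (polynomial-size D)
  where
  open ≤-Reasoning
  polynomial-size : ∀ {n} (D : Digraph n) → f n ≤ c * size (encodeDigraph D) ^ d + c
  polynomial-size {n} D = begin
    f n                                 ≤⟨ f≤ n ⟩
    c * suc n ^ d                       ≤⟨ *-monoʳ-≤ c (^-monoˡ-≤ d
      (size-encodeVec bits (tabulate λ v → tabulate (D v)))) ⟩
    c * size (encodeDigraph D) ^ d      ≤⟨ m≤m+n _ c ⟩
    c * size (encodeDigraph D) ^ d + c  ∎

orientedTree-solvable : ∀ {n} (D : Digraph n) → IsOrientedTree D →
  SolvedWithin D (Cost.programCost n (tableBound n) (roundBound n))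
orientedTree-solvable D (G , tree , orientation)
  with a , loop , opt ← OrientedTree.solved D G tree orientation =
  a , OrientedTree.optimum-minimal D G tree orientation opt ,
  Algorithm.program-runs D loop (QuasiKernels.initial-small D
    (OrientedTree.loopless D G tree orientation))

proposition3p2 : PolynomialTimeSolvableOn MinQuasiKernel OrientationsOfTrees
proposition3p2 = polynomial-solvable programCost-poly orientedTree-solvable
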